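{- Let $k,\Delta$ be positive integers and let $\varepsilon>0$. Every finite graph $G$ with maximum degree $\Delta$ and treewidth less than $k$ has a subdivision $\tilde G$ with growth $f_{\tilde G}(r)\leq (18k\Delta^2+\varepsilon)r+1$ for every positive integer $r$.
   Context: The growth of a finite graph $G$ is the function $f_G\colon\mathbb{N}\to\mathbb{N}$ where $f_G(r)$ is the maximum of $|V(H)|$ over all subgraphs $H$ of $G$ of radius at most $r$. Treewidth is the minimum, over tree-decompositions (bags indexed by the nodes of a tree, each edge contained in some bag, the bags containing any given vertex forming a non-empty subtree), of the maximum bag size minus $1$. A subdivision of $G$ is a graph obtained by replacing each edge $vw$ by a path with endpoints $v$ and $w$, internally disjoint from the rest of the graph. -}

module Defs where

open import Level using (Level; 0ℓ; _⊔_)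
open import Data.Nat using (ℕ; suc; _≤_; _<_; _∸_)
open import Data.Fin using (Fin)
open import Data.Fin.Subset using (Subset; _∈_; ∣_∣)
open import Data.Integer using (+_)
open import Data.List using (List; _∷_; _++_; _∷ʳ_; map; allFin; length; reverse)
open import Data.List.Extrema.Nat using (max)
open import Data.List.Membership.Propositional using () renaming (_∈_ to _∈ˡ_)
open import Data.List.Relation.Unary.Linked using (Linked)
open import Data.List.Relation.Unary.Unique.Propositional using (Unique)
open import Data.Product using (Σ; ∃; _×_)
open import Data.Rational using (ℚ; _/_)
open import Data.Sum using (_⊎_)
open import Data.Vec using (tabulate)
open import Function using (_∘_; _⇔_)
open import Function.Definitions using (Injective)
open import Relation.Binary using (Rel; Decidable; Symmetric; Irreflexive)
open import Relation.Binary.Construct.Closure.ReflexiveTransitive using (Star)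
open import Relation.Binary.PropositionalEquality using (_≡_; _≢_)
open import Relation.Nullary using (¬_; does)
open import Relation.Unary using (Pred; Satisfiable; U)

private
  variable
    a ℓ : Level
    A : Set a

IsMinimum : Pred ℕ ℓ → Pred ℕ ℓ
IsMinimum P m = P m × (∀ n → P n → m ≤ n)

IsMaximum : Pred ℕ ℓ → Pred ℕ ℓ
IsMaximum P m = P m × (∀ n → P n → n ≤ m)

fromℕ : ℕ → ℚ
fromℕ n = + n / 1

-- Finite simple undirected graphs.  Every finite graph is isomorphic to one
-- whose vertex set is an initial segment of ℕ.
record Graph : Set₁ where
  infix 4 _∼_ _∼?_
  field
    order  : ℕ
    _∼_    : Rel (Fin order) 0ℓ
    _∼?_   : Decidable _∼_
    sym    : Symmetric _∼_
    irrefl : Irreflexive _≡_ _∼_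

  Vertex : Set
  Vertex = Fin order

  neighbours : Vertex → Subset order
  neighbours v = tabulate (λ w → does (v ∼? w))

  degree : Vertex → ℕ
  degree v = ∣ neighbours v ∣

  maxDegree : ℕ
  maxDegree = max 0 (map degree (allFin order))

-- The subgraph induced by P is non-empty and connected.
Connected : Pred A 0ℓ → Rel A 0ℓ → Set _
Connected P R = Satisfiable P
              × (∀ {u v} → P u → P v → Star (λ x y → P x × P y × R x y) u v)

-- A cycle x, y₁, …, yₙ, x visits at least three distinct vertices.
Acyclic : Rel A 0ℓ → Set _
Acyclic R = ∀ x ys → 2 ≤ length ys → Unique (x ∷ ys) → ¬ Linked R (x ∷ ys ∷ʳ x)

IsTree : Graph → Set
IsTree T = Connected U _∼_ × Acyclic _∼_
  where open Graph T

record TreeDecomposition (G : Graph) : Set₁ where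
  private module G = Graph G
  field
    tree   : Graph
    isTree : IsTree tree
  private module T = Graph tree
  field
    bag         : T.Vertex → Subset G.order
    edgeCovered : ∀ {u v} → u G.∼ v → ∃ λ t → u ∈ bag t × v ∈ bag t
    -- A connected induced subgraph of a tree is a subtree.
    subtree     : ∀ v → Connected (λ t → v ∈ bag t) T._∼_

  -- Truncated subtraction matters only for the graph with no vertices, which
  -- gets width 0 instead of -1.
  width : ℕ
  width = max 0 (map (∣_∣ ∘ bag) (allFin T.order)) ∸ 1

IsTreewidth : Graph → ℕ → Set₁
IsTreewidth G = IsMinimum (λ w → Σ (TreeDecomposition G) λ D →
                                 TreeDecomposition.width D ≡ w)

TreewidthLessThan : Graph → ℕ → Set₁
TreewidthLessThan G k = ∃ λ w → IsTreewidth G w × w < k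

data Walk {A : Set a} (R : Rel A ℓ) : ℕ → A → A → Set (a ⊔ ℓ) where
  []  : ∀ {u} → Walk R 0 u u
  _∷_ : ∀ {n u v w} → R u v → Walk R n v w → Walk R (suc n) u w

DistanceAtMost : Rel A ℓ → ℕ → A → A → Set _
DistanceAtMost R r u v = ∃ λ n → n ≤ r × Walk R n u v

-- Arbitrary (not necessarily induced) subgraphs.
record Subgraph (G : Graph) : Set₁ where
  open Graph G
  field
    vertices  : Subset order
    Edge      : Rel Vertex 0ℓ
    edge?     : Decidable Edge
    edgeSym   : Symmetric Edge
    edge⇒∼    : ∀ {u v} → Edge u v → u ∼ v
    endpoints : ∀ {u v} → Edge u v → u ∈ vertices × v ∈ vertices

  RadiusAtMost : ℕ → Set
  RadiusAtMost r = ∃ λ c → c ∈ vertices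
                 × (∀ v → v ∈ vertices → DistanceAtMost Edge r c v)

IsGrowth : (G : Graph) → (ℕ → ℕ) → Set₁
IsGrowth G f = ∀ r → IsMaximum (λ m → Σ (Subgraph G) λ H →
    Subgraph.RadiusAtMost H r × ∣ Subgraph.vertices H ∣ ≡ m) (f r)

Consecutive : List A → A → A → Set _
Consecutive zs x y = ∃ λ xs → ∃ λ ys → zs ≡ xs ++ x ∷ y ∷ ys

-- Each edge vw of G becomes the path  branch v, inner v w, branch w  of H.
-- The value of inner v w is irrelevant when v and w are not adjacent.
record IsSubdivisionOf (H G : Graph) : Set where
  private
    module G = Graph G
    module H = Graph H
  field
    branch : G.Vertex → H.Vertex
    inner  : G.Vertex → G.Vertex → List H.Vertex

  path : G.Vertex → G.Vertex → List H.Vertex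
  path v w = branch v ∷ inner v w ∷ʳ branch w

  field
    branchInjective : Injective _≡_ _≡_ branch
    innerReverse    : ∀ {v w} → v G.∼ w → inner w v ≡ reverse (inner v w)
    innerUnique     : ∀ {v w} → v G.∼ w → Unique (inner v w)
    inner≢branch    : ∀ {v w} → v G.∼ w → ∀ {x} → x ∈ˡ inner v w → ∀ u → x ≢ branch u
    innerDisjoint   : ∀ {v w v′ w′} → v G.∼ w → v′ G.∼ w′ →
                      ∀ {x} → x ∈ˡ inner v w → x ∈ˡ inner v′ w′ →
                      (v ≡ v′ × w ≡ w′) ⊎ (v ≡ w′ × w ≡ v′)
    vertexCovered   : ∀ x → (∃ λ v → x ≡ branch v)
                          ⊎ (∃ λ v → ∃ λ w → v G.∼ w × x ∈ˡ inner v w)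
    edges           : ∀ x y → x H.∼ y ⇔
                      (∃ λ v → ∃ λ w → v G.∼ w × Consecutive (path v w) x y)

{-# OPTIONS --safe #-}
-- Root the decomposition tree.  The vertices of G whose topmost bag lies in the subtree below a
-- node t form a cluster.  The edges leaving this cluster all meet the bag of t, and so do the edges
-- inside it that have an end with topmost bag t; hence there are at most kΔ edges of either kind.
-- Let the height of a vertex increase as its topmost bag gets closer to the root, let the level of
-- an edge be the height of its higher end, and subdivide the edge into a path whose length depends
-- on the level only and grows so fast that each path is longer than all paths of lower levels
-- together.  Given r, choose i such that paths of level i - 1 are shorter than r and paths of level
-- i are not.  A walk of length r from a branch vertex stays in one cluster and in initial pieces of
-- the paths leaving it.  It therefore meets at most r vertices on levels below i - 1, at most kΔ
-- paths of level i - 1, each shorter than r, and at most kΔ pieces of length r, in total at most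
-- 3kΔr vertices.  If the centre is an inner vertex of a path, the ball is covered by 2r + 1
-- vertices of that path and by two such sets, one for each end, so it has at most 9kΔr ≤ 18kΔ²r
-- vertices.
module Submission where

open import Defs

module LinearGrowth where
  open import Data.Fin as Fin using (Fin)
  import Data.Fin.Properties as Fin
  open import Data.Fin.Subset using (Subset; inside; outside; _∈_; ∣_∣; ⁅_⁆; _∪_; ⊥)
  open import Data.Fin.Subset.Properties
    using (p⊆q⇒∣p∣≤∣q∣; x∈p∪q⁺; x∈⁅x⁆; ∣⁅x⁆∣≡1; ∣⊥∣≡0; _∈?_)
  open import Data.List
    using (List; []; _∷_; _++_; _∷ʳ_; map; length; reverse; lookup; filter; allFin; upTo; applyUpTo;
           applyDownFrom; concatMap; cartesianProduct)
  open import Data.List.Extrema.Nat using (max; argmax; f[xs]≤f[argmax]; xs≤max)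
  open import Data.List.Membership.Propositional using (lose) renaming (_∈_ to _∈ˡ_)
  open import Data.List.Membership.Propositional.Properties
    using (∈-map⁺; ∈-allFin; ∈-lookup; ∈-filter⁺; ∈-filter⁻; ∈-cartesianProduct⁺; ∈-upTo⁺; ∈-applyUpTo⁺;
           ∈-applyUpTo⁻; ∈-concatMap⁺; ∈-++⁺ˡ; ∈-++⁺ʳ)
  open import Data.List.Properties
    using (length-map; length-++; length-tabulate; length-applyUpTo; applyUpTo-∷ʳ; reverse-applyUpTo;
           ∷-injective)
  open import Data.List.Relation.Unary.All as All using (All)
  open import Data.List.Relation.Unary.All.Properties using (¬Any⇒All¬)
  open import Data.List.Relation.Unary.AllPairs using (_∷_; [])
  open import Data.List.Relation.Unary.Any using (here; there; index; any?)
  open import Data.List.Relation.Unary.Any.Properties using (lookup-index)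
  open import Data.List.Relation.Unary.Linked using (Linked; [-]; _∷_)
  open import Data.List.Relation.Unary.Unique.Propositional using (Unique)
  import Data.List.Relation.Unary.Unique.Propositional.Properties as Unique
  open import Data.Nat
  open import Data.Nat.Induction using (<-wellFounded)
  open import Data.Nat.Properties
  open import Data.Nat.Tactic.RingSolver using (solve-∀)
  open import Data.Product using (∃; _×_; _,_; proj₁; proj₂)
  open import Data.Sum using (_⊎_; inj₁; inj₂)
  open import Data.Unit using (tt)
  open import Data.Vec using ([]; _∷_; here; there; tabulate)
  open import Data.Vec.Properties using ([]=⇒lookup; lookup⇒[]=; lookup∘tabulate)
  open import Function using (_∘_; id; mk⇔)
  open import Induction.WellFounded using (Acc; acc)
  open import Level using (Level; 0ℓ)
  open import Relation.Binary using (Rel; DecidableEquality)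
  open import Relation.Binary.Construct.Closure.ReflexiveTransitive as Star using (Star; ε; _◅_; _◅◅_)
  open import Relation.Binary.PropositionalEquality
  open import Relation.Nullary using (¬_; Dec; yes; no; does; contradiction; _×-dec_; _⊎-dec_)
  open import Relation.Nullary.Decidable using (dec-true; map′)
  import Relation.Unary as U

  private
    variable
      a b c : Level
      A : Set a
      B : Set b
      n : ℕ

  -- Finite sets, covering lists and extrema.

  comprehension : {P : U.Pred (Fin n) c} → U.Decidable P → Subset n
  comprehension P? = tabulate (does ∘ P?)

  module _ {P : U.Pred (Fin n) c} (P? : U.Decidable P) where

    ∈-comprehension⁺ : ∀ {x} → P x → x ∈ comprehension P?
    ∈-comprehension⁺ {x} px =
      lookup⇒[]= x _ (trans (lookup∘tabulate (does ∘ P?) x) (dec-true (P? x) px))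

    ∈-comprehension⁻ : ∀ {x} → x ∈ comprehension P? → P x
    ∈-comprehension⁻ {x} x∈ with P? x | trans (sym (lookup∘tabulate (does ∘ P?) x)) ([]=⇒lookup x∈)
    ... | yes px | _ = px
    ... | no _   | ()

  elements : Subset n → List (Fin n)
  elements []            = []
  elements (inside  ∷ p) = Fin.zero ∷ map Fin.suc (elements p)
  elements (outside ∷ p) = map Fin.suc (elements p)

  length-elements : (p : Subset n) → length (elements p) ≡ ∣ p ∣
  length-elements []            = refl
  length-elements (inside  ∷ p) = cong suc (trans (length-map Fin.suc (elements p)) (length-elements p))
  length-elements (outside ∷ p) = trans (length-map Fin.suc (elements p)) (length-elements p)

  ∈-elements : ∀ {x} {p : Subset n} → x ∈ p → x ∈ˡ elements p
  ∈-elements here = here refl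
  ∈-elements {p = inside  ∷ p} (there x∈) = there (∈-map⁺ Fin.suc (∈-elements x∈))
  ∈-elements {p = outside ∷ p} (there x∈) = ∈-map⁺ Fin.suc (∈-elements x∈)

  ∣p∪q∣≤∣p∣+∣q∣ : (p q : Subset n) → ∣ p ∪ q ∣ ≤ ∣ p ∣ + ∣ q ∣
  ∣p∪q∣≤∣p∣+∣q∣ []            []            = z≤n
  ∣p∪q∣≤∣p∣+∣q∣ (outside ∷ p) (outside ∷ q) = ∣p∪q∣≤∣p∣+∣q∣ p q
  ∣p∪q∣≤∣p∣+∣q∣ (outside ∷ p) (inside  ∷ q) =
    ≤-trans (s≤s (∣p∪q∣≤∣p∣+∣q∣ p q)) (≤-reflexive (sym (+-suc ∣ p ∣ ∣ q ∣)))
  ∣p∪q∣≤∣p∣+∣q∣ (inside  ∷ p) (outside ∷ q) = s≤s (∣p∪q∣≤∣p∣+∣q∣ p q)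
  ∣p∪q∣≤∣p∣+∣q∣ (inside  ∷ p) (inside  ∷ q) =
    s≤s (≤-trans (∣p∪q∣≤∣p∣+∣q∣ p q) (+-monoʳ-≤ ∣ p ∣ (n≤1+n ∣ q ∣)))

  -- `xs` may have repetitions, so lists covering overlapping pieces can simply be concatenated.
  cover⇒∣p∣≤length : (p : Subset n) (xs : List (Fin n)) →
                     (∀ {x} → x ∈ p → x ∈ˡ xs) → ∣ p ∣ ≤ length xs
  cover⇒∣p∣≤length {n = n} p xs p⊆xs =
    ≤-trans (p⊆q⇒∣p∣≤∣q∣ (λ x∈ → ∈-union (p⊆xs x∈))) (∣union∣ xs)
    where
    union : List (Fin n) → Subset n
    union []       = ⊥
    union (x ∷ xs) = ⁅ x ⁆ ∪ union xs

    ∈-union : ∀ {x xs} → x ∈ˡ xs → x ∈ union xs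
    ∈-union (here refl) = x∈p∪q⁺ (inj₁ (x∈⁅x⁆ _))
    ∈-union (there x∈)  = x∈p∪q⁺ (inj₂ (∈-union x∈))

    ∣union∣ : ∀ xs → ∣ union xs ∣ ≤ length xs
    ∣union∣ []       = ≤-reflexive (∣⊥∣≡0 n)
    ∣union∣ (x ∷ xs) = ≤-trans (∣p∪q∣≤∣p∣+∣q∣ ⁅ x ⁆ (union xs))
      (+-mono-≤ (≤-reflexive (∣⁅x⁆∣≡1 x)) (∣union∣ xs))

  length-concatMap-≤ : (f : A → List B) (xs : List A) {m : ℕ} →
                       (∀ x → length (f x) ≤ m) → length (concatMap f xs) ≤ length xs * m
  length-concatMap-≤ f []       h = z≤n
  length-concatMap-≤ f (x ∷ xs) h =
    ≤-trans (≤-reflexive (length-++ (f x))) (+-mono-≤ (h x) (length-concatMap-≤ f xs h))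

  abstract
    Fin-bounded : (f : Fin n → ℕ) → ∃ λ m → ∀ i → f i ≤ m
    Fin-bounded f = max 0 (map f (allFin _)) , λ i →
      All.lookup (xs≤max 0 (map f (allFin _))) (∈-map⁺ f (∈-allFin i))

    Fin-argmax : Fin n → (f : Fin n → ℕ) → ∃ λ i → ∀ j → f j ≤ f i
    Fin-argmax i₀ f = argmax f i₀ (allFin _) , λ j →
      All.lookup (f[xs]≤f[argmax] i₀ (allFin _)) (∈-allFin j)

    least : {P : U.Pred ℕ c} → U.Decidable P → ∀ {m} → P m →
            ∃ λ l → P l × (∀ {j} → P j → l ≤ j)
    least {P = P} P? {m} pm = go (<-wellFounded m) pm
      where
      go : ∀ {m} → Acc _<_ m → P m → ∃ λ l → P l × (∀ {j} → P j → l ≤ j)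
      go {m} (acc rs) pm with anyUpTo? P? m
      ... | yes (j , j<m , pj) = go (rs j<m) pj
      ... | no ∄              = m , pm , λ pj → ≮⇒≥ λ j<m → ∄ (_ , j<m , pj)

  -- Walks, balls and growth.

  module _ {R : Rel A c} where

    infixl 5 _∷ʳʷ_
    _∷ʳʷ_ : ∀ {m u v w} → Walk R m u v → R v w → Walk R (suc m) u w
    []      ∷ʳʷ e′ = e′ ∷ []
    (e ∷ p) ∷ʳʷ e′ = e ∷ (p ∷ʳʷ e′)

    Star⇒Walk : ∀ {u v} → Star R u v → ∃ λ m → Walk R m u v
    Star⇒Walk ε        = 0 , []
    Star⇒Walk (e ◅ es) with m , p ← Star⇒Walk es = suc m , e ∷ p

  module Balls (G : Graph) where
    open Graph G renaming (sym to ∼-sym)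

    walk? : ∀ m u v → Dec (Walk _∼_ m u v)
    walk? zero u v = map′ (λ { refl → [] }) (λ { [] → refl }) (u Fin.≟ v)
    walk? (suc m) u v = map′ (λ { (w , e , p) → e ∷ p }) (λ { (e ∷ p) → _ , e , p })
      (Fin.any? λ w → (u ∼? w) ×-dec walk? m w v)

    distanceAtMost? : ∀ r u v → Dec (DistanceAtMost _∼_ r u v)
    distanceAtMost? r u v = map′ (λ { (m , s≤s m≤r , p) → m , m≤r , p })
      (λ { (m , m≤r , p) → m , s≤s m≤r , p }) (anyUpTo? (λ m → walk? m u v) (suc r))

    abstract
      ball : Vertex → ℕ → Subset order
      ball c r = comprehension (distanceAtMost? r c)

      ∈-ball⁺ : ∀ {c r v} → DistanceAtMost _∼_ r c v → v ∈ ball c r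
      ∈-ball⁺ {c} {r} = ∈-comprehension⁺ (distanceAtMost? r c)

      ∈-ball⁻ : ∀ {c r v} → v ∈ ball c r → DistanceAtMost _∼_ r c v
      ∈-ball⁻ {c} {r} = ∈-comprehension⁻ (distanceAtMost? r c)

    ballSubgraph : Vertex → ℕ → Subgraph G
    ballSubgraph c r = record
      { vertices  = ball c r
      ; Edge      = λ u v → u ∼ v × u ∈ ball c r × v ∈ ball c r
      ; edge?     = λ u v → (u ∼? v) ×-dec ((u ∈? ball c r) ×-dec (v ∈? ball c r))
      ; edgeSym   = λ { (e , u∈ , v∈) → ∼-sym e , v∈ , u∈ }
      ; edge⇒∼    = proj₁
      ; endpoints = proj₂
      }

    -- Every vertex of a walk of length at most `r` from `c` is the end of a prefix of it, so the
    -- walk stays in the ball. `go` carries this prefix along to place both ends of the next edge.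
    ball-radius : ∀ c r → Subgraph.RadiusAtMost (ballSubgraph c r) r
    ball-radius c r = c , ∈-ball⁺ (0 , z≤n , []) , λ v v∈ → restrict (∈-ball⁻ v∈)
      where
      go : ∀ {i j u v} → Walk _∼_ i c u → Walk _∼_ j u v → i + j ≤ r →
           Walk (Subgraph.Edge (ballSubgraph c r)) j u v
      go p [] _ = []
      go {i} {suc j} p (e ∷ q) i+j≤r =
        (e , ∈-ball⁺ (i , ≤-trans (m≤m+n i (suc j)) i+j≤r , p)
           , ∈-ball⁺ (suc i , ≤-trans (s≤s (m≤m+n i j)) i+j≤r′ , p ∷ʳʷ e))
        ∷ go (p ∷ʳʷ e) q i+j≤r′
        where i+j≤r′ = subst (_≤ r) (+-suc i j) i+j≤r

      restrict : ∀ {v} → DistanceAtMost _∼_ r c v →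
                 DistanceAtMost (Subgraph.Edge (ballSubgraph c r)) r c v
      restrict (m , m≤r , p) = m , m≤r , go [] p m≤r

    -- The vertices of a subgraph of radius at most `r` lie in the ball around its centre, and the
    -- ball induces such a subgraph itself. So it suffices to maximise over balls; `c₀` ensures that
    -- there is one.
    growth : Vertex → ∃ λ f → IsGrowth G f × (∀ r → ∃ λ c → f r ≡ ∣ ball c r ∣)
    growth c₀ = f , isGrowth , λ r → centre r , refl
      where
      centre : ℕ → Vertex
      centre r = proj₁ (Fin-argmax c₀ (λ c → ∣ ball c r ∣))

      f : ℕ → ℕ
      f r = ∣ ball (centre r) r ∣

      isGrowth : IsGrowth G f
      isGrowth r = (ballSubgraph (centre r) r , ball-radius (centre r) r , refl)
        , λ { m (H , (c , _ , near) , refl) →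
              ≤-trans (p⊆q⇒∣p∣≤∣q∣ λ {v} v∈ →
                  ∈-ball⁺ (let j , j≤r , p = near v v∈ in j , j≤r , forget H p))
                (proj₂ (Fin-argmax c₀ (λ c → ∣ ball c r ∣)) c) }
        where
        forget : ∀ (H : Subgraph G) {j u v} → Walk (Subgraph.Edge H) j u v → Walk _∼_ j u v
        forget H []      = []
        forget H (e ∷ p) = Subgraph.edge⇒∼ H e ∷ forget H p

  -- Subdividing each edge by a prescribed number of vertices.

  lookup-injective : {xs : List A} → Unique xs → ∀ {i j} → lookup xs i ≡ lookup xs j → i ≡ j
  lookup-injective (_ ∷ _)     {Fin.zero}  {Fin.zero}  _  = refl
  lookup-injective (x∉ ∷ _)    {Fin.zero}  {Fin.suc j} eq = contradiction eq (All.lookup x∉ (∈-lookup j))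
  lookup-injective (x∉ ∷ _)    {Fin.suc i} {Fin.zero}  eq = contradiction (sym eq) (All.lookup x∉ (∈-lookup i))
  lookup-injective (_ ∷ uniq)  {Fin.suc i} {Fin.suc j} eq = cong Fin.suc (lookup-injective uniq eq)

  consecutive-applyUpTo⁺ : (f : ℕ → A) {n p : ℕ} → suc p < n →
                           Consecutive (applyUpTo f n) (f p) (f (suc p))
  consecutive-applyUpTo⁺ f {suc (suc n)} {zero}  _         = [] , applyUpTo (f ∘ suc ∘ suc) n , refl
  consecutive-applyUpTo⁺ f {suc n}       {suc p} (s≤s p<n)
    with xs , ys , eq ← consecutive-applyUpTo⁺ (f ∘ suc) p<n = f 0 ∷ xs , ys , cong (f 0 ∷_) eq

  consecutive-applyUpTo⁻ : (f : ℕ → A) (n : ℕ) {x y : A} → Consecutive (applyUpTo f n) x y →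
                           ∃ λ p → suc p < n × x ≡ f p × y ≡ f (suc p)
  consecutive-applyUpTo⁻ f (suc (suc n)) ([] , ys , refl) = 0 , s≤s (s≤s z≤n) , refl , refl
  consecutive-applyUpTo⁻ f zero          ([] , ys , ())
  consecutive-applyUpTo⁻ f (suc zero)    ([] , ys , ())
  consecutive-applyUpTo⁻ f zero          (_ ∷ xs , ys , ())
  consecutive-applyUpTo⁻ f (suc n)       (_ ∷ xs , ys , eq)
    with p , p<n , x≡ , y≡ ← consecutive-applyUpTo⁻ (f ∘ suc) n (xs , ys , proj₂ (∷-injective eq))
    = suc p , s≤s p<n , x≡ , y≡

  applyUpTo≡applyDownFrom : (f g : ℕ → A) (n : ℕ) → (∀ p → p < n → f p ≡ g (n ∸ suc p)) →
                            applyUpTo f n ≡ applyDownFrom g n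
  applyUpTo≡applyDownFrom f g zero    h = refl
  applyUpTo≡applyDownFrom f g (suc n) h = cong₂ _∷_ (h 0 (s≤s z≤n))
    (applyUpTo≡applyDownFrom (f ∘ suc) g n (λ p p<n → h (suc p) (s≤s p<n)))

  data Position (l : ℕ) : ℕ → Set where
    start  : Position l 0
    middle : ∀ {p} → 1 ≤ p → p ≤ l → Position l p
    end    : Position l (suc l)

  position : ∀ {l p} → p ≤ suc l → Position l p
  position {p = zero}  _ = start
  position {l} {suc p} p≤ with suc p ≤? l
  ... | yes p≤l = middle (s≤s z≤n) p≤l
  ... | no  p≰l rewrite ≤-antisym (≤-pred p≤) (≤-pred (≰⇒> p≰l)) = end

  -- `ℓ v w` is the number of inner vertices on the path replacing the edge `vw`; positions 0 and
  -- `suc (ℓ v w)` on it are the ends `v` and `w`.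
  module Subdivide (G : Graph) (ℓ : Graph.Vertex G → Graph.Vertex G → ℕ)
                   (ℓ-sym : ∀ v w → ℓ v w ≡ ℓ w v) where
    open Graph G renaming (sym to ∼-sym)

    -- (v , v , 0) encodes a branch vertex and (v , w , p) with v < w the p-th vertex of the path
    -- from v to w.
    Code : Set
    Code = Vertex × Vertex × ℕ

    Valid : Code → Set
    Valid (v , w , p) = (w ≡ v × p ≡ 0) ⊎ (v Fin.< w × v ∼ w × 1 ≤ p × p ≤ ℓ v w)

    valid? : ∀ c → Dec (Valid c)
    valid? (v , w , p) = ((w Fin.≟ v) ×-dec (p ≟ 0))
      ⊎-dec ((v Fin.<? w) ×-dec ((v ∼? w) ×-dec ((1 ≤? p) ×-dec (p ≤? ℓ v w))))

    bound : ∃ λ m → ∀ v w → ℓ v w ≤ m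
    bound with m , ≤m ← Fin-bounded (λ v → proj₁ (Fin-bounded (ℓ v)))
      = m , λ v w → ≤-trans (proj₂ (Fin-bounded (ℓ v)) w) (≤m v)

    abstract
      -- The finite box `universe` contains all valid codes. Filtering leaves each of them exactly
      -- once, so that indices into `codes` can serve as the vertices of the subdivision.
      universe codes : List Code
      universe = cartesianProduct (allFin order) (cartesianProduct (allFin order) (upTo (suc (proj₁ bound))))
      codes    = filter valid? universe

      codes-unique : Unique codes
      codes-unique = Unique.filter⁺ valid? (Unique.cartesianProduct⁺ (Unique.allFin⁺ order)
        (Unique.cartesianProduct⁺ (Unique.allFin⁺ order) (Unique.upTo⁺ _)))

      valid⇒∈codes : ∀ {c} → Valid c → c ∈ˡ codes
      valid⇒∈codes {v , w , p} val = ∈-filter⁺ valid?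
        (∈-cartesianProduct⁺ (∈-allFin v) (∈-cartesianProduct⁺ (∈-allFin w) (∈-upTo⁺ (s≤s (p≤ val))))) val
        where
        p≤ : ∀ {v w p} → Valid (v , w , p) → p ≤ proj₁ bound
        p≤ (inj₁ (_ , refl))        = z≤n
        p≤ (inj₂ (_ , _ , _ , p≤ℓ)) = ≤-trans p≤ℓ (proj₂ bound _ _)

      ∈codes⇒valid : ∀ {c} → c ∈ˡ codes → Valid c
      ∈codes⇒valid c∈ = proj₂ (∈-filter⁻ valid? {xs = universe} c∈)

    -- An inner vertex has one position counted from each end of its path, and the two add up to
    -- `suc (ℓ v w)`. The position from the smaller end is chosen.
    canon : Vertex → Vertex → ℕ → Code
    canon v w p with v Fin.<? w
    ... | yes _ = v , w , p
    ... | no _  = w , v , suc (ℓ v w) ∸ p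

    -- The fallback to `w` is the intended value at position `suc (ℓ v w)` of an edge; elsewhere it
    -- is a default that keeps the code valid.
    code : Vertex → Vertex → ℕ → Code
    code v w zero = v , v , 0
    code v w (suc p) with (v ∼? w) ×-dec (suc p ≤? ℓ v w)
    ... | yes _ = canon v w (suc p)
    ... | no _  = w , w , 0

    ∼⇒≢ : ∀ {v w} → v ∼ w → v ≢ w
    ∼⇒≢ e refl = irrefl refl e

    flip-bounds : ∀ {l p} → 1 ≤ p → p ≤ l → 1 ≤ suc l ∸ p × suc l ∸ p ≤ l
    flip-bounds {l} {suc p} _ p≤l = m<n⇒0<n∸m p≤l , m∸n≤m l p

    canon-valid : ∀ {v w p} → v ∼ w → 1 ≤ p → p ≤ ℓ v w → Valid (canon v w p)
    canon-valid {v} {w} {p} e 1≤p p≤ with v Fin.<? w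
    ... | yes v<w = inj₂ (v<w , e , 1≤p , p≤)
    ... | no  v≮w with 1≤q , q≤ ← flip-bounds 1≤p p≤ =
      inj₂ (≤∧≢⇒< (≮⇒≥ v≮w) (λ eq → ∼⇒≢ e (sym (Fin.toℕ-injective eq)))
           , ∼-sym e , 1≤q , subst (suc (ℓ v w) ∸ p ≤_) (ℓ-sym v w) q≤)

    code-valid : ∀ v w p → Valid (code v w p)
    code-valid v w zero = inj₁ (refl , refl)
    code-valid v w (suc p) with (v ∼? w) ×-dec (suc p ≤? ℓ v w)
    ... | yes (e , p≤) = canon-valid e (s≤s z≤n) p≤
    ... | no _         = inj₁ (refl , refl)

    code-middle : ∀ {v w p} → v ∼ w → 1 ≤ p → p ≤ ℓ v w → code v w p ≡ canon v w p
    code-middle {v} {w} {suc p} e _ p≤ with (v ∼? w) ×-dec (suc p ≤? ℓ v w)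
    ... | yes _ = refl
    ... | no ¬x = contradiction (e , p≤) ¬x

    code-end : ∀ v w → code v w (suc (ℓ v w)) ≡ (w , w , 0)
    code-end v w with (v ∼? w) ×-dec (suc (ℓ v w) ≤? ℓ v w)
    ... | yes (_ , ℓ<ℓ) = contradiction ℓ<ℓ (n≮n _)
    ... | no _          = refl

    canon-reverse : ∀ {v w p} → v ∼ w → p ≤ ℓ v w → canon w v (suc (ℓ v w) ∸ p) ≡ canon v w p
    canon-reverse {v} {w} {p} e p≤ with w Fin.<? v | v Fin.<? w
    ... | yes w<v | yes v<w = contradiction v<w (<-asym w<v)
    ... | yes w<v | no _    = refl
    ... | no _    | yes _   = cong (λ q → v , w , q)
      (trans (cong (λ l → suc l ∸ (suc (ℓ v w) ∸ p)) (ℓ-sym w v)) (m∸[m∸n]≡n (m≤n⇒m≤1+n p≤)))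
    ... | no w≮v  | no v≮w  =
      contradiction (Fin.toℕ-injective (≤-antisym (≮⇒≥ w≮v) (≮⇒≥ v≮w))) (∼⇒≢ e)

    SamePoint : Vertex → Vertex → ℕ → Vertex → Vertex → ℕ → Set
    SamePoint v w p v′ w′ p′ = (v ≡ v′ × w ≡ w′ × p ≡ p′)
                             ⊎ (v ≡ w′ × w ≡ v′ × p ≡ suc (ℓ v w) ∸ p′)

    canon-injective : ∀ {v w p v′ w′ p′} → p ≤ ℓ v w → p′ ≤ ℓ v′ w′ →
                      canon v w p ≡ canon v′ w′ p′ → SamePoint v w p v′ w′ p′
    canon-injective {v} {w} {p} {v′} {w′} {p′} p≤ p′≤ eq
      with v Fin.<? w | v′ Fin.<? w′
    ... | yes _ | yes _ with refl ← eq = inj₁ (refl , refl , refl)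
    ... | yes _ | no _  with refl ← eq = inj₂ (refl , refl , cong (λ l → suc l ∸ p′) (ℓ-sym w v))
    ... | no _  | yes _ with refl ← eq = inj₂ (refl , refl , sym (m∸[m∸n]≡n (m≤n⇒m≤1+n p≤)))
    ... | no _  | no _  with refl ← cong proj₁ eq | refl ← cong (proj₁ ∘ proj₂) eq
      = inj₁ (refl , refl , ∸-cancelˡ-≡ (m≤n⇒m≤1+n p≤) (m≤n⇒m≤1+n p′≤) (cong (proj₂ ∘ proj₂) eq))

    canon≢branch : ∀ {v w p u} → v ∼ w → canon v w p ≢ (u , u , 0)
    canon≢branch {v} {w} e eq with v Fin.<? w
    ... | yes _ with refl ← eq = irrefl refl e
    ... | no _  with refl ← cong proj₁ eq | refl ← cong (proj₁ ∘ proj₂) eq = irrefl refl e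

    Point : Set
    Point = Fin (length codes)

    abstract
      point : Vertex → Vertex → ℕ → Point
      point v w p = index (valid⇒∈codes (code-valid v w p))

      decode-point : ∀ v w p → code v w p ≡ lookup codes (point v w p)
      decode-point v w p = lookup-index (valid⇒∈codes (code-valid v w p))

    branch : Vertex → Point
    branch v = point v v 0

    code⇒point : ∀ {v w p v′ w′ p′} → code v w p ≡ code v′ w′ p′ → point v w p ≡ point v′ w′ p′
    code⇒point eq = lookup-injective codes-unique
      (trans (sym (decode-point _ _ _)) (trans eq (decode-point _ _ _)))

    point⇒code : ∀ {v w p v′ w′ p′} → point v w p ≡ point v′ w′ p′ → code v w p ≡ code v′ w′ p′
    point⇒code eq = trans (decode-point _ _ _) (trans (cong (lookup codes) eq) (sym (decode-point _ _ _)))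

    point-start : ∀ v w → point v w 0 ≡ branch v
    point-start v w = code⇒point refl

    point-end : ∀ v w → point v w (suc (ℓ v w)) ≡ branch w
    point-end v w = code⇒point (code-end v w)

    branch-injective : ∀ {v w} → branch v ≡ branch w → v ≡ w
    branch-injective eq = cong proj₁ (point⇒code eq)

    point≢branch : ∀ {v w p u} → v ∼ w → 1 ≤ p → p ≤ ℓ v w → point v w p ≢ branch u
    point≢branch e 1≤p p≤ eq =
      canon≢branch e (trans (sym (code-middle e 1≤p p≤)) (point⇒code eq))

    point-injective : ∀ {v w p v′ w′ p′} → v ∼ w → 1 ≤ p → p ≤ ℓ v w →
                      v′ ∼ w′ → 1 ≤ p′ → p′ ≤ ℓ v′ w′ →
                      point v w p ≡ point v′ w′ p′ → SamePoint v w p v′ w′ p′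
    point-injective e 1≤p p≤ e′ 1≤p′ p′≤ eq = canon-injective p≤ p′≤
      (trans (sym (code-middle e 1≤p p≤)) (trans (point⇒code eq) (code-middle e′ 1≤p′ p′≤)))

    point-reverse : ∀ {v w p} → v ∼ w → p ≤ suc (ℓ v w) → point w v (suc (ℓ v w) ∸ p) ≡ point v w p
    point-reverse {v} {w} e p≤ with position p≤
    ... | start rewrite ℓ-sym v w = trans (point-end w v) (sym (point-start v w))
    ... | middle {p} 1≤p p≤ℓ with 1≤q , q≤ ← flip-bounds 1≤p p≤ℓ = code⇒point (begin
      code w v (suc (ℓ v w) ∸ p)   ≡⟨ code-middle (∼-sym e) 1≤q (subst (suc (ℓ v w) ∸ p ≤_) (ℓ-sym v w) q≤) ⟩
      canon w v (suc (ℓ v w) ∸ p)  ≡⟨ canon-reverse e p≤ℓ ⟩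
      canon v w p                  ≡⟨ code-middle e 1≤p p≤ℓ ⟨
      code v w p                   ∎)
      where open ≡-Reasoning
    ... | end = begin
      point w v (ℓ v w ∸ ℓ v w)  ≡⟨ cong (point w v) (n∸n≡0 (ℓ v w)) ⟩
      point w v 0                ≡⟨ point-start w v ⟩
      branch w                   ≡⟨ point-end v w ⟨
      point v w (suc (ℓ v w))    ∎
      where open ≡-Reasoning

    point-consecutive-≢ : ∀ {v w p} → v ∼ w → p ≤ ℓ v w → point v w p ≢ point v w (suc p)
    point-consecutive-≢ {v} {w} {p} e p≤ eq with suc p ≤? ℓ v w
    point-consecutive-≢ {v} {w} {zero}  e p≤ eq | yes p< =
      point≢branch e (s≤s z≤n) p< (trans (sym eq) (point-start v w))
    point-consecutive-≢ {v} {w} {suc p} e p≤ eq | yes p<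
      with point-injective e (s≤s z≤n) p≤ e (s≤s z≤n) p< eq
    ... | inj₁ (_ , _ , p≡) = 1+n≢n (sym p≡)
    ... | inj₂ (v≡w , _)    = ∼⇒≢ e v≡w
    point-consecutive-≢ {v} {w} {p} e p≤ eq | no p≮ = not-branch p p≤
      (trans eq (trans (cong (point v w ∘ suc) (≤-antisym p≤ (≤-pred (≰⇒> p≮)))) (point-end v w)))
      where
      not-branch : ∀ p → p ≤ ℓ v w → point v w p ≢ branch w
      not-branch zero    _  eq′ = ∼⇒≢ e (branch-injective (trans (sym (point-start v w)) eq′))
      not-branch (suc p) p≤ eq′ = point≢branch e (s≤s z≤n) p≤ eq′

    -- Each edge of `G` enters in both orientations. Symmetry is therefore `point-reverse`: the step
    -- from position `p` to `suc p`, read from the other end, starts at `ℓ v w ∸ p`.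
    Adjacent : Point → Point → Set
    Adjacent x y = ∃ λ v → ∃ λ w → ∃ λ p → p < suc (ℓ v w) × v ∼ w × x ≡ point v w p × y ≡ point v w (suc p)

    subdivision : Graph
    subdivision = record
      { order  = length codes
      ; _∼_    = Adjacent
      ; _∼?_   = λ x y → Fin.any? λ v → Fin.any? λ w → anyUpTo?
          (λ p → (v ∼? w) ×-dec ((x Fin.≟ point v w p) ×-dec (y Fin.≟ point v w (suc p)))) (suc (ℓ v w))
      ; sym    = λ { (v , w , p , p< , e , refl , refl) → w , v , ℓ v w ∸ p
          , s≤s (≤-trans (m∸n≤m (ℓ v w) p) (≤-reflexive (ℓ-sym v w))) , ∼-sym e
          , sym (point-reverse e p<)
          , trans (sym (point-reverse e (<⇒≤ p<))) (cong (point w v) (+-∸-assoc 1 (≤-pred p<))) }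
      ; irrefl = λ { refl (v , w , p , p< , e , refl , eq) → point-consecutive-≢ e (≤-pred p<) eq }
      }

    branch-step : ∀ {v y} → Adjacent (branch v) y → ∃ λ w → v ∼ w × y ≡ point v w 1
    branch-step (v′ , w′ , zero , _ , e , eq , y≡)
      with refl ← branch-injective (trans eq (point-start v′ w′)) = w′ , e , y≡
    branch-step (v′ , w′ , suc p , p< , e , eq , y≡) =
      contradiction (sym eq) (point≢branch e (s≤s z≤n) (≤-pred p<))

    -- An inner vertex determines its path up to orientation. A step along the path oriented as
    -- `v w` leads to the successor, a step along its reversal to the predecessor.
    middle-step : ∀ {v w p y} → v ∼ w → 1 ≤ p → p ≤ ℓ v w → Adjacent (point v w p) y →
                  y ≡ point v w (suc p) ⊎ y ≡ point v w (pred p)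
    middle-step e 1≤p p≤ (v′ , w′ , zero , _ , e′ , eq , y≡) =
      contradiction (trans eq (point-start v′ w′)) (point≢branch e 1≤p p≤)
    middle-step e 1≤p p≤ (v′ , w′ , suc q , q< , e′ , eq , y≡)
      with point-injective e 1≤p p≤ e′ (s≤s z≤n) (≤-pred q<) eq
    ... | inj₁ (refl , refl , refl) = inj₁ y≡
    ... | inj₂ (refl , refl , refl) = inj₂ (trans y≡ (trans (sym (point-reverse e′ q<))
      (cong (point w′ v′) (trans (cong (_∸ suc q) (ℓ-sym v′ w′)) (sym (pred[m∸n]≡m∸[1+n] (ℓ w′ v′) q))))))

    point-cover : ∀ x → (∃ λ v → x ≡ branch v)
                      ⊎ (∃ λ v → ∃ λ w → ∃ λ p → v ∼ w × 1 ≤ p × p ≤ ℓ v w × x ≡ point v w p)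
    point-cover x with lookup codes x in eq | ∈codes⇒valid (∈-lookup {xs = codes} x)
    ... | c@(v , w , p) | val with val
    ... | inj₁ (refl , refl) = inj₁ (v , lookup-injective codes-unique (trans eq (decode-point v v 0)))
    ... | inj₂ (v<w , e , 1≤p , p≤) = inj₂ (v , w , p , e , 1≤p , p≤ ,
      lookup-injective codes-unique (trans eq (trans code≡ (decode-point v w p))))
      where
      code≡ : (v , w , p) ≡ code v w p
      code≡ with v Fin.<? w | code-middle e 1≤p p≤
      ... | yes _  | eq′ = sym eq′
      ... | no v≮w | _   = contradiction v<w v≮w

    inner : Vertex → Vertex → List Point
    inner v w = applyUpTo (point v w ∘ suc) (ℓ v w)

    ∈-inner⁻ : ∀ {v w x} → x ∈ˡ inner v w → ∃ λ p → 1 ≤ p × p ≤ ℓ v w × x ≡ point v w p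
    ∈-inner⁻ {v} {w} x∈ with i , i< , x≡ ← ∈-applyUpTo⁻ (point v w ∘ suc) x∈ = suc i , s≤s z≤n , i< , x≡

    path≡ : ∀ v w → branch v ∷ inner v w ∷ʳ branch w ≡ applyUpTo (point v w) (suc (suc (ℓ v w)))
    path≡ v w = cong₂ _∷_ (sym (point-start v w)) (trans
      (cong (inner v w ∷ʳ_) (sym (point-end v w)))
      (applyUpTo-∷ʳ (point v w ∘ suc) (ℓ v w)))

    isSubdivision : IsSubdivisionOf subdivision G
    isSubdivision = record
      { branch          = branch
      ; inner           = inner
      ; branchInjective = branch-injective
      ; innerReverse    = inner-reverse
      ; innerUnique     = λ {v} {w} e → Unique.applyUpTo⁺₁ (point v w ∘ suc) (ℓ v w)
          λ i<j j< eq → distinct e i<j (point-injective e (s≤s z≤n) (<-trans i<j j<) e (s≤s z≤n) j< eq)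
      ; inner≢branch    = λ e x∈ u → λ { refl → let p , 1≤p , p≤ , x≡ = ∈-inner⁻ x∈ in
          point≢branch e 1≤p p≤ (sym x≡) }
      ; innerDisjoint   = λ e e′ x∈ x∈′ →
          let p , 1≤p , p≤ , x≡ = ∈-inner⁻ x∈
              q , 1≤q , q≤ , x≡′ = ∈-inner⁻ x∈′
          in same-edge (point-injective e 1≤p p≤ e′ 1≤q q≤ (trans (sym x≡) x≡′))
      ; vertexCovered   = λ x → covered (point-cover x)
      ; edges           = λ x y → mk⇔
          (λ { (v , w , p , p< , e , refl , refl) → v , w , e ,
               subst (λ zs → Consecutive zs (point v w p) (point v w (suc p))) (sym (path≡ v w))
                     (consecutive-applyUpTo⁺ (point v w) (s≤s p<)) })
          (λ { (v , w , e , con) →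
               let p , p< , x≡ , y≡ = consecutive-applyUpTo⁻ (point v w) _
                                        (subst (λ zs → Consecutive zs x y) (path≡ v w) con)
               in v , w , p , ≤-pred p< , e , x≡ , y≡ })
      }
      where
      same-edge : ∀ {v w p v′ w′ p′} → SamePoint v w p v′ w′ p′ → (v ≡ v′ × w ≡ w′) ⊎ (v ≡ w′ × w ≡ v′)
      same-edge (inj₁ (v≡ , w≡ , _)) = inj₁ (v≡ , w≡)
      same-edge (inj₂ (v≡ , w≡ , _)) = inj₂ (v≡ , w≡)

      distinct : ∀ {v w i j} → v ∼ w → i < j → ¬ SamePoint v w (suc i) v w (suc j)
      distinct e i<j (inj₁ (_ , _ , i≡j)) = <⇒≢ i<j (cong pred i≡j)
      distinct e i<j (inj₂ (v≡w , _))     = ∼⇒≢ e v≡w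

      inner-reverse : ∀ {v w} → v ∼ w → inner w v ≡ reverse (inner v w)
      inner-reverse {v} {w} e rewrite ℓ-sym w v = trans
        (applyUpTo≡applyDownFrom (point w v ∘ suc) (point v w ∘ suc) (ℓ v w) λ p p< → trans
          (sym (point-reverse (∼-sym e) (s≤s (≤-trans (<⇒≤ p<) (≤-reflexive (ℓ-sym v w))))))
          (cong (point v w) (trans (cong (_∸ p) (ℓ-sym w v)) (+-∸-assoc 1 p<))))
        (sym (reverse-applyUpTo (point v w ∘ suc) (ℓ v w)))

      covered : ∀ {x} → (∃ λ v → x ≡ branch v)
                      ⊎ (∃ λ v → ∃ λ w → ∃ λ p → v ∼ w × 1 ≤ p × p ≤ ℓ v w × x ≡ point v w p) →
                (∃ λ v → x ≡ branch v) ⊎ (∃ λ v → ∃ λ w → v ∼ w × x ∈ˡ inner v w)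
      covered (inj₁ b) = inj₁ b
      covered (inj₂ (v , w , suc p , e , _ , p≤ , refl)) =
        inj₂ (v , w , e , ∈-applyUpTo⁺ (point v w ∘ suc) p≤)

  -- Layerings and the growth of path lengths.

  -- The vertices of height at most i fall into clusters.  A cluster is recorded by its separator, which
  -- contains its vertices of height i and all neighbours of the cluster outside it.
  record Layering (G : Graph) (k : ℕ) : Set where
    open Graph G
    field
      height     : Vertex → ℕ
      separator  : ℕ → Vertex → Subset order
      ∣separator∣ : ∀ i v → ∣ separator i v ∣ ≤ k
      same       : ∀ {i v w} → v ∼ w → height v ≤ i → height w ≤ i → separator i v ≡ separator i w
      own        : ∀ v → v ∈ separator (height v) v
      cut        : ∀ {i v w} → v ∼ w → height v ≤ i → i < height w → w ∈ separator i v

  module Scales (n : ℕ) where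

    -- Paths of level i have scale (suc i) inner vertices; this bounds the number of branch vertices and of
    -- inner vertices of paths of levels below i.
    scale : ℕ → ℕ
    scale zero    = 0
    scale (suc i) = n + n * (n * scale i)

    module _ (1≤n : 1 ≤ n) where

      scale-< : ∀ i → scale i < scale (suc i)
      -- The summand `n` gives strictness, and `n * (n * scale i)` is at least `scale i`.
      scale-< i = +-mono-≤ 1≤n (≤-trans (≤-reflexive (sym (trans (*-identityˡ _) (*-identityˡ _))))
                                        (*-mono-≤ 1≤n (*-monoˡ-≤ (scale i) 1≤n)))

      scale-mono : ∀ {i j} → i ≤ j → scale i ≤ scale j
      scale-mono i≤j = go (≤⇒≤′ i≤j)
        where
        go : ∀ {i j} → i ≤′ j → scale i ≤ scale j
        go ≤′-refl               = ≤-refl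
        go (≤′-step {j} i≤j) = ≤-trans (go i≤j) (<⇒≤ (scale-< j))

      scale-≥ : ∀ i → i ≤ scale i
      scale-≥ zero    = z≤n
      scale-≥ (suc i) = ≤-trans (s≤s (scale-≥ i)) (scale-< i)

      -- The search runs downwards from index `r`, where `scale-≥` applies, and stops before index 0
      -- because `scale 0` is 0.
      scale-of : ∀ {r} → 1 ≤ r → ∃ λ i → scale i < r × r ≤ scale (suc i)
      scale-of {r} 1≤r = go r (scale-≥ r)
        where
        go : ∀ i → r ≤ scale i → ∃ λ i → scale i < r × r ≤ scale (suc i)
        go zero    r≤0 = contradiction (≤-trans 1≤r r≤0) (λ ())
        go (suc i) r≤  with scale i <? r
        ... | yes s<r = i , s<r , r≤
        ... | no  s≮r = go i (≮⇒≥ s≮r)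

  -- Covering the balls of the subdivision.

  module Counting (G : Graph) {k Δ : ℕ} (1≤k : 1 ≤ k) (1≤Δ : 1 ≤ Δ) (1≤n : 1 ≤ Graph.order G)
                  (degree≤Δ : ∀ v → Graph.degree G v ≤ Δ) (L : Layering G k) where
    open Graph G renaming (sym to ∼-sym)
    open Layering L
    open Scales order

    level : Vertex → Vertex → ℕ
    level v w = height v ⊔ height w

    ℓ : Vertex → Vertex → ℕ
    ℓ v w = scale (suc (level v w))

    ℓ-sym : ∀ v w → ℓ v w ≡ ℓ w v
    ℓ-sym v w = cong (scale ∘ suc) (⊔-comm (height v) (height w))

    open Subdivide G ℓ ℓ-sym
    open Balls subdivision using (ball; ∈-ball⁻; growth)

    segment : ℕ → Vertex → Vertex → List Point
    segment m v w = applyUpTo (point v w ∘ suc) m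

    ∈-segment : ∀ {m v w p} → 1 ≤ p → p ≤ m → point v w p ∈ˡ segment m v w
    ∈-segment {v = v} {w} {suc p} _ p≤m = ∈-applyUpTo⁺ (point v w ∘ suc) p≤m

    length-segment : ∀ m v w → length (segment m v w) ≤ m
    length-segment m v w = ≤-reflexive (length-applyUpTo (point v w ∘ suc) m)

    1≤ℓ : ∀ v w → 1 ≤ ℓ v w
    1≤ℓ v w = ≤-trans 1≤n (m≤m+n _ _)

    module AtScale (i : ℕ) {r : ℕ} (scale<r : scale i < r) (r≤scale : r ≤ scale (suc i)) where

      r≤ℓ : ∀ {v w} → i ≤ level v w → r ≤ ℓ v w
      r≤ℓ i≤ = ≤-trans r≤scale (scale-mono 1≤n (s≤s i≤))

      1≤r : 1 ≤ r
      1≤r = ≤-trans (s≤s z≤n) scale<r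

      -- A walk of length at most r cannot traverse the path of an edge of level at least i.
      data Zone (K : Vertex → Set) (m : ℕ) : Point → Set where
        at   : ∀ {v} → K v → Zone K m (branch v)
        low  : ∀ {v w p} → K v → v ∼ w → level v w < i → 1 ≤ p → p ≤ ℓ v w → Zone K m (point v w p)
        high : ∀ {v w p} → K v → v ∼ w → i ≤ level v w → 1 ≤ p → p ≤ m → Zone K m (point v w p)

      -- A short walk may traverse the path of an edge of level below `i`, so the other end must
      -- belong to `K` as well.
      Closed : (Vertex → Set) → Set
      Closed K = ∀ {v w} → K v → v ∼ w → level v w < i → K w

      module _ {K : Vertex → Set} {m : ℕ} where

        at-start : ∀ {v w} → K v → Zone K m (point v w 0)
        at-start {v} {w} kv = subst (Zone K m) (sym (point-start v w)) (at kv)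

        at-end : ∀ {v w p} → K w → p ≤ ℓ v w → ¬ (suc p ≤ ℓ v w) → Zone K m (point v w (suc p))
        at-end {v} {w} kw p≤ p≮ = subst (Zone K m)
          (trans (sym (point-end v w)) (cong (point v w ∘ suc) (≤-antisym (≤-pred (≰⇒> p≮)) p≤))) (at kw)

      -- A path of low level may be left at its far end, which is in `K` by closedness. On a path of
      -- high level the position is at most `m < r ≤ ℓ v w`, so one more step cannot reach the far
      -- end. Turning back leads to the near end, which is in `K` anyway.
      zone-step : ∀ {K m x y} → Closed K → Zone K m x → Adjacent x y → m < r → Zone K (suc m) y
      zone-step closed (at {v} kv) e m<r with w , v∼w , refl ← branch-step e with level v w <? i
      ... | yes l<i = low kv v∼w l<i (s≤s z≤n) (1≤ℓ v w)
      ... | no  l≮i = high kv v∼w (≮⇒≥ l≮i) (s≤s z≤n) (s≤s z≤n)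
      zone-step closed (low {v} {w} {p} kv v∼w l<i 1≤p p≤) e m<r with middle-step v∼w 1≤p p≤ e
      ... | inj₁ refl with suc p ≤? ℓ v w
      ...   | yes p< = low kv v∼w l<i (s≤s z≤n) p<
      ...   | no  p≮ = at-end (closed kv v∼w l<i) p≤ p≮
      zone-step closed (low {p = suc zero}    kv v∼w l<i 1≤p p≤) e m<r | inj₂ refl = at-start kv
      zone-step closed (low {p = suc (suc p)} kv v∼w l<i 1≤p p≤) e m<r | inj₂ refl =
        low kv v∼w l<i (s≤s z≤n) (<⇒≤ p≤)
      zone-step closed (high {v} {w} {p} kv v∼w i≤l 1≤p p≤m) e m<r
        with middle-step v∼w 1≤p (≤-trans p≤m (≤-trans (<⇒≤ m<r) (r≤ℓ i≤l))) e
      ... | inj₁ refl = high kv v∼w i≤l (s≤s z≤n) (s≤s p≤m)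
      zone-step closed (high {p = suc zero}    kv v∼w i≤l 1≤p p≤m) e m<r | inj₂ refl = at-start kv
      zone-step closed (high {p = suc (suc p)} kv v∼w i≤l 1≤p p≤m) e m<r | inj₂ refl =
        high kv v∼w i≤l (s≤s z≤n) (m≤n⇒m≤1+n (<⇒≤ p≤m))

      record ZoneCover (u : Vertex) : Set₁ where
        field
          K       : Vertex → Set
          centre  : K u
          closed  : Closed K
          list    : List Point
          covers  : ∀ {m x} → m ≤ r → Zone K m x → x ∈ˡ list
          length≤ : length list ≤ 3 * (k * Δ * r)

      r≤kΔr : r ≤ k * Δ * r
      r≤kΔr = ≤-trans (≤-reflexive (sym (*-identityˡ r))) (*-monoˡ-≤ r (*-mono-≤ 1≤k 1≤Δ))

      -- All edges at `u` have level at least `i`, so no path starting at `u` can be traversed. Only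
      -- `u` and at most `Δ` spokes of length `r` remain.
      singletonCover : ∀ u → i ≤ height u → ZoneCover u
      singletonCover u i≤hu = record
        { K       = λ v → v ≡ u
        ; centre  = refl
        ; closed  = λ { refl e l<i → contradiction (≤-trans i≤hu (m≤m⊔n _ _)) (<⇒≱ l<i) }
        ; list    = branch u ∷ spokes
        ; covers  = covers
        ; length≤ = begin
            1 + length spokes
              ≤⟨ +-monoʳ-≤ 1 (length-concatMap-≤ (segment r u) (elements (neighbours u)) (length-segment r u)) ⟩
            1 + length (elements (neighbours u)) * r
              ≡⟨ cong (λ d → 1 + d * r) (length-elements (neighbours u)) ⟩
            1 + degree u * r
              ≤⟨ +-mono-≤ (≤-trans 1≤r r≤kΔr) (*-monoˡ-≤ r (≤-trans (degree≤Δ u) Δ≤kΔ)) ⟩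
            k * Δ * r + k * Δ * r
              ≤⟨ +-monoʳ-≤ (k * Δ * r) (m≤m+n _ _) ⟩
            3 * (k * Δ * r) ∎
        }
        where
        open ≤-Reasoning

        Δ≤kΔ : Δ ≤ k * Δ
        Δ≤kΔ = ≤-trans (≤-reflexive (sym (*-identityˡ Δ))) (*-monoˡ-≤ Δ 1≤k)

        spokes : List Point
        spokes = concatMap (segment r u) (elements (neighbours u))

        covers : ∀ {m x} → m ≤ r → Zone (_≡ u) m x → x ∈ˡ branch u ∷ spokes
        covers m≤r (at refl)                  = here refl
        covers m≤r (low refl e l<i _ _)       = contradiction (≤-trans i≤hu (m≤m⊔n _ _)) (<⇒≱ l<i)
        covers m≤r (high refl e i≤l 1≤p p≤m)  = there (∈-concatMap⁺ (segment r u)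
          (lose (∈-elements (∈-comprehension⁺ (u ∼?_) e)) (∈-segment 1≤p (≤-trans p≤m m≤r))))

    incidences : Subset order → List (Vertex × Vertex)
    incidences S = concatMap (λ s → map (s ,_) (elements (neighbours s))) (elements S)

    ∈-incidences : ∀ {S s w} → s ∈ S → s ∼ w → (s , w) ∈ˡ incidences S
    ∈-incidences {s = s} s∈S s∼w = ∈-concatMap⁺ (λ s → map (s ,_) (elements (neighbours s)))
      (lose (∈-elements s∈S) (∈-map⁺ (s ,_) (∈-elements (∈-comprehension⁺ (s ∼?_) s∼w))))

    length-incidences : ∀ i u → length (incidences (separator i u)) ≤ k * Δ
    length-incidences i u = ≤-trans
      (length-concatMap-≤ (λ s → map (s ,_) (elements (neighbours s))) (elements S) λ s →
        ≤-trans (≤-reflexive (trans (length-map (s ,_) (elements (neighbours s)))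
                                    (length-elements (neighbours s))))
                (degree≤Δ s))
      (*-monoˡ-≤ Δ (≤-trans (≤-reflexive (length-elements S)) (∣separator∣ i u)))
      where S = separator i u

    module _ (j : ℕ) {r : ℕ} (scale<r : scale (suc j) < r) (r≤scale : r ≤ scale (suc (suc j))) where
      open AtScale (suc j) scale<r r≤scale

      -- Here the scale index is `suc j`. Membership in the cluster of `u` is expressed as equality
      -- of separators, so `K` may unite several clusters. The count survives: `branches` and
      -- `lower` range over the whole graph, while `top` and `leaving` depend only on the edges at
      -- `S`.
      clusterCover : ∀ u → height u ≤ j → ZoneCover u
      clusterCover u hu≤j = record
        { K       = K
        ; centre  = hu≤j , refl
        ; closed  = λ { (hv≤j , eq) e l<i → let hw≤j = ≤-trans (m≤n⊔m _ _) (≤-pred l<i) in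
                        hw≤j , trans (sym (same e hv≤j hw≤j)) eq }
        ; list    = branches ++ lower ++ top ++ leaving
        ; covers  = covers
        ; length≤ = begin
            length (branches ++ lower ++ top ++ leaving)
              ≡⟨ trans (length-++ branches) (cong (length branches +_)
                   (trans (length-++ lower) (cong (length lower +_) (length-++ top)))) ⟩
            length branches + (length lower + (length top + length leaving))
              ≤⟨ +-mono-≤ ∣branches∣ (+-mono-≤ ∣lower∣ (+-mono-≤ ∣top∣ ∣leaving∣)) ⟩
            order + (order * (order * scale j) + (k * Δ * scale (suc j) + k * Δ * r))
              -- The recursion for `scale` is made for this step: the first two summands are
              -- `scale (suc j)` by definition.
              ≡⟨ +-assoc order _ _ ⟨
            scale (suc j) + (k * Δ * scale (suc j) + k * Δ * r)
              ≤⟨ +-mono-≤ (≤-trans (<⇒≤ scale<r) r≤kΔr) (+-monoˡ-≤ (k * Δ * r) (*-monoʳ-≤ (k * Δ) (<⇒≤ scale<r))) ⟩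
            k * Δ * r + (k * Δ * r + k * Δ * r)
              ≡⟨ cong (λ t → k * Δ * r + (k * Δ * r + t)) (+-identityʳ (k * Δ * r)) ⟨
            3 * (k * Δ * r) ∎
        }
        where
        open ≤-Reasoning

        S : Subset order
        S = separator j u

        K : Vertex → Set
        K v = height v ≤ j × separator j v ≡ S

        branches lower top leaving : List Point
        branches = map branch (allFin order)
        lower    = concatMap (λ v → concatMap (segment (scale j) v) (allFin order)) (allFin order)
        top      = concatMap (λ { (s , w) → segment (scale (suc j)) s w }) (incidences S)
        leaving  = concatMap (λ { (s , w) → segment r w s }) (incidences S)

        ∣allFin∣ : length (allFin order) ≡ order
        ∣allFin∣ = length-tabulate {n = order} id

        ∣branches∣ : length branches ≤ order
        ∣branches∣ = ≤-reflexive (trans (length-map branch (allFin order)) ∣allFin∣)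

        ∣lower∣ : length lower ≤ order * (order * scale j)
        ∣lower∣ = subst (λ n → length lower ≤ n * (n * scale j)) ∣allFin∣
          (length-concatMap-≤ _ (allFin order) λ v →
           length-concatMap-≤ _ (allFin order) (length-segment (scale j) v))

        ∣top∣ : length top ≤ k * Δ * scale (suc j)
        ∣top∣ = ≤-trans (length-concatMap-≤ _ (incidences S) λ { (s , w) → length-segment (scale (suc j)) s w })
          (*-monoˡ-≤ (scale (suc j)) (length-incidences j u))

        ∣leaving∣ : length leaving ≤ k * Δ * r
        ∣leaving∣ = ≤-trans (length-concatMap-≤ _ (incidences S) λ { (s , w) → length-segment r w s })
          (*-monoˡ-≤ r (length-incidences j u))

        in-top : ∀ {x s w} → s ∈ S → s ∼ w → x ∈ˡ segment (scale (suc j)) s w →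
                 x ∈ˡ branches ++ lower ++ top ++ leaving
        in-top s∈S e x∈ = ∈-++⁺ʳ branches (∈-++⁺ʳ lower (∈-++⁺ˡ
          (∈-concatMap⁺ (λ { (s , w) → segment (scale (suc j)) s w }) (lose (∈-incidences s∈S e) x∈))))

        own′ : ∀ {v} → height v ≡ j → separator j v ≡ S → v ∈ S
        own′ {v} hv≡j eq = subst (v ∈_) (trans (cong (λ i → separator i v) hv≡j) eq) (own v)

        covers : ∀ {m x} → m ≤ r → Zone K m x → x ∈ˡ branches ++ lower ++ top ++ leaving
        covers m≤r (at {v} _) = ∈-++⁺ˡ (∈-map⁺ branch (∈-allFin v))
        covers m≤r (low {v} {w} {p} (hv≤j , eq) e l<i 1≤p p≤) with level v w <? j
        ... | yes l<j = ∈-++⁺ʳ branches (∈-++⁺ˡ (∈-concatMap⁺ (λ v → concatMap (segment (scale j) v) (allFin order))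
          (lose (∈-allFin v) (∈-concatMap⁺ (segment (scale j) v)
            (lose (∈-allFin w) (∈-segment 1≤p (≤-trans p≤ (scale-mono 1≤n l<j))))))))
        -- The level is exactly `j`, so one of the two ends has height `j` and lies in `S` by `own`.
        ... | no  l≮j with l≡j ← ≤-antisym (≤-pred l<i) (≮⇒≥ l≮j) with ⊔-sel (height v) (height w)
        ...   | inj₁ l≡hv = in-top (own′ (trans (sym l≡hv) l≡j) eq) e
                (∈-segment 1≤p (≤-trans p≤ (≤-reflexive (cong (scale ∘ suc) l≡j))))
        -- The end in `S` is now `w`, so the path is listed from `w` and the position has to be
        -- reversed.
        ...   | inj₂ l≡hw = in-top (own′ hw≡j (trans (sym (same e hv≤j (≤-reflexive hw≡j))) eq)) (∼-sym e)
                (subst (_∈ˡ segment (scale (suc j)) w v) (point-reverse e (m≤n⇒m≤1+n p≤))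
                  (let 1≤q , q≤ = flip-bounds 1≤p p≤ in
                   ∈-segment 1≤q (≤-trans q≤ (≤-reflexive (cong (scale ∘ suc) l≡j)))))
          where hw≡j = trans (sym l≡hw) l≡j
        -- As `v` has height at most `j`, the level is attained by `w` alone, and `cut` places `w`
        -- in `S`. The piece itself is listed from `v`, where the walk enters the path.
        covers m≤r (high {v} {w} (hv≤j , eq) e j<l 1≤p p≤m) =
          ∈-++⁺ʳ branches (∈-++⁺ʳ lower (∈-++⁺ʳ top
            (∈-concatMap⁺ (λ { (s , w) → segment r w s })
              (lose (∈-incidences (subst (w ∈_) eq (cut e hv≤j j<hw)) (∼-sym e)) (∈-segment 1≤p (≤-trans p≤m m≤r))))))
          where
          j<hw : j < height w
          j<hw with height w ≤? j
          ... | yes hw≤j = contradiction (⊔-lub hv≤j hw≤j) (<⇒≱ j<l)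
          ... | no  hw≰j = ≰⇒> hw≰j

    module _ (i : ℕ) {r : ℕ} (scale<r : scale i < r) (r≤scale : r ≤ scale (suc i)) where
      open AtScale i scale<r r≤scale

      zoneCover : ∀ u → ZoneCover u
      zoneCover u with i ≤? height u
      ... | yes i≤hu = singletonCover u i≤hu
      ... | no  i≰hu = fromCluster i scale<r r≤scale (≰⇒> i≰hu)
        where
        -- The index is generalised so that `height u < i′` can force it to be a successor.
        fromCluster : ∀ i′ (s< : scale i′ < r) (s≥ : r ≤ scale (suc i′)) → height u < i′ →
                      AtScale.ZoneCover i′ s< s≥ u
        fromCluster (suc j) s< s≥ (s≤s hu≤j) = clusterCover j s< s≥ u hu≤j

      walk-invariant : (P : ℕ → Point → Set) →
                       (∀ {m x y} → P m x → Adjacent x y → m < r → P (suc m) y) →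
                       ∀ {m l x y} → P m x → Walk Adjacent l x y → m + l ≤ r → P (m + l) y
      walk-invariant P step {m} {x = x} px [] _ = subst (λ m → P m x) (sym (+-identityʳ m)) px
      walk-invariant P step {m} {suc l} {y = y} px (e ∷ walk) m+l≤r =
        subst (λ m → P m y) (sym (+-suc m l))
          (walk-invariant P step (step px e (≤-trans (s≤s (m≤m+n m l)) m+l<r)) walk m+l<r)
        where m+l<r = subst (_≤ r) (+-suc m l) m+l≤r

      -- The last two bounds say that `p` and `q` differ by at most `m`, without truncated
      -- subtraction.
      data Near (a b : Vertex) (q m : ℕ) : Point → Set where
        near : ∀ {p} → 1 ≤ p → p ≤ ℓ a b → p ≤ q + m → q ≤ p + m → Near a b q m (point a b p)

      module _ {a b : Vertex} (a∼b : a ∼ b) {Kᵃ Kᵇ : Vertex → Set} (kᵃ : Kᵃ a) (kᵇ : Kᵇ b)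
               (closedᵃ : Closed Kᵃ) (closedᵇ : Closed Kᵇ) {q : ℕ} where

        Reach : ℕ → Point → Set
        Reach m x = Near a b q m x ⊎ Zone Kᵃ m x ⊎ Zone Kᵇ m x

        -- Until the walk first meets an end of the path it moves by single positions. From then on
        -- it is in the zone of that end, which also accounts for a return to the same path.
        reach-step : ∀ {m x y} → Reach m x → Adjacent x y → m < r → Reach (suc m) y
        reach-step (inj₂ (inj₁ z)) e m<r = inj₂ (inj₁ (zone-step closedᵃ z e m<r))
        reach-step (inj₂ (inj₂ z)) e m<r = inj₂ (inj₂ (zone-step closedᵇ z e m<r))
        reach-step {m} (inj₁ (near {p} 1≤p p≤ p≤q+m q≤p+m)) e m<r with middle-step a∼b 1≤p p≤ e
        ... | inj₁ refl with suc p ≤? ℓ a b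
        ...   | yes p< = inj₁ (near (s≤s z≤n) p<
                  (subst (suc p ≤_) (sym (+-suc q m)) (s≤s p≤q+m))
                  (≤-trans q≤p+m (≤-trans (+-monoʳ-≤ p (n≤1+n m)) (n≤1+n _))))
        ...   | no  p≮ = inj₂ (inj₂ (at-end kᵇ p≤ p≮))
        reach-step     (inj₁ (near {suc zero}    1≤p p≤ p≤q+m q≤p+m)) e m<r | inj₂ refl = inj₂ (inj₁ (at-start kᵃ))
        reach-step {m} (inj₁ (near {suc (suc p)} 1≤p p≤ p≤q+m q≤p+m)) e m<r | inj₂ refl =
          inj₁ (near (s≤s z≤n) (<⇒≤ p≤) (≤-trans (n≤1+n _) (≤-trans p≤q+m (+-monoʳ-≤ q (n≤1+n m))))
                     (subst (λ t → q ≤ suc t) (sym (+-suc p m)) q≤p+m))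

      -- The list starts at the truncated `q ∸ r` and may run past the end of the path, which only
      -- adds entries.
      nearList : Vertex → Vertex → ℕ → List Point
      nearList a b q = applyUpTo (λ s → point a b (q ∸ r + s)) (r + r + 1)

      near⇒∈ : ∀ {a b q m x} → m ≤ r → Near a b q m x → x ∈ˡ nearList a b q
      near⇒∈ {a} {b} {q} {m} m≤r (near {p} 1≤p p≤ p≤q+m q≤p+m) =
        subst (_∈ˡ nearList a b q) (cong (point a b) (m+[n∸m]≡n q∸r≤p))
          (∈-applyUpTo⁺ (λ s → point a b (q ∸ r + s)) p∸<)
        where
        open ≤-Reasoning
        q∸r≤p : q ∸ r ≤ p
        q∸r≤p = m≤n+o⇒m∸n≤o q r (≤-trans q≤p+m (≤-trans (+-monoʳ-≤ p m≤r) (≤-reflexive (+-comm p r))))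

        p∸< : p ∸ (q ∸ r) < r + r + 1
        p∸< = begin-strict
          p ∸ (q ∸ r)  ≤⟨ m≤n+o⇒m∸n≤o p (q ∸ r) (begin
              p                    ≤⟨ p≤q+m ⟩
              q + m                ≤⟨ +-mono-≤ (m≤n+m∸n q r) m≤r ⟩
              (r + (q ∸ r)) + r    ≡⟨ cong (_+ r) (+-comm r (q ∸ r)) ⟩
              ((q ∸ r) + r) + r    ≡⟨ +-assoc (q ∸ r) r r ⟩
              (q ∸ r) + (r + r)    ∎) ⟩
          r + r        <⟨ m<m+n (r + r) (s≤s z≤n) ⟩
          r + r + 1    ∎

      ∣ball∣≤-at-scale : ∀ c → ∣ ball c r ∣ ≤ 9 * (k * Δ * r)
      ∣ball∣≤-at-scale c with point-cover c
      ... | inj₁ (a , refl) = begin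
        ∣ ball c r ∣      ≤⟨ cover⇒∣p∣≤length _ (A.list) (λ x∈ → in-list (∈-ball⁻ x∈)) ⟩
        length A.list     ≤⟨ A.length≤ ⟩
        3 * (k * Δ * r)   ≤⟨ *-monoˡ-≤ (k * Δ * r) (m≤m+n 3 6) ⟩
        9 * (k * Δ * r)   ∎
        where
        open ≤-Reasoning
        module A = ZoneCover (zoneCover a)

        in-list : ∀ {x} → DistanceAtMost Adjacent r c x → x ∈ˡ A.list
        in-list (m , m≤r , walk) = A.covers m≤r
          (walk-invariant (Zone A.K) (zone-step A.closed) (at A.centre) walk m≤r)
      ... | inj₂ (a , b , q , a∼b , 1≤q , q≤ , refl) = begin
        ∣ ball c r ∣
          ≤⟨ cover⇒∣p∣≤length _ (nearList a b q ++ A.list ++ B.list)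
               (λ x∈ → in-list (∈-ball⁻ x∈)) ⟩
        length (nearList a b q ++ A.list ++ B.list)
          ≡⟨ trans (length-++ (nearList a b q)) (cong₂ _+_ (length-applyUpTo _ (r + r + 1)) (length-++ A.list)) ⟩
        r + r + 1 + (length A.list + length B.list)
          -- Each of `r`, `r` and 1 is at most `t`, and each end contributes `3 * t`.
          ≤⟨ +-mono-≤ (+-mono-≤ (+-mono-≤ r≤kΔr r≤kΔr) (≤-trans 1≤r r≤kΔr)) (+-mono-≤ A.length≤ B.length≤) ⟩
        t + t + t + (3 * t + 3 * t)
          ≡⟨ nine t ⟩
        9 * t ∎
        where
        open ≤-Reasoning
        module A = ZoneCover (zoneCover a)
        module B = ZoneCover (zoneCover b)
        t = k * Δ * r

        nine : ∀ t → t + t + t + (3 * t + 3 * t) ≡ 9 * t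
        nine = solve-∀

        in-list : ∀ {x} → DistanceAtMost Adjacent r c x → x ∈ˡ nearList a b q ++ A.list ++ B.list
        in-list (m , m≤r , walk) with walk-invariant (Reach a∼b {A.K} {B.K} A.centre B.centre A.closed B.closed)
          (reach-step a∼b A.centre B.centre A.closed B.closed)
          (inj₁ (near 1≤q q≤ (m≤m+n q 0) (m≤m+n q 0))) walk m≤r
        ... | inj₁ n        = ∈-++⁺ˡ (near⇒∈ m≤r n)
        ... | inj₂ (inj₁ z) = ∈-++⁺ʳ (nearList a b q) (∈-++⁺ˡ (A.covers m≤r z))
        ... | inj₂ (inj₂ z) = ∈-++⁺ʳ (nearList a b q) (∈-++⁺ʳ A.list (B.covers m≤r z))

    ∣ball∣≤ : ∀ c {r} → 1 ≤ r → ∣ ball c r ∣ ≤ 9 * (k * Δ * r)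
    ∣ball∣≤ c 1≤r with i , s<r , r≤s ← scale-of 1≤n 1≤r = ∣ball∣≤-at-scale i s<r r≤s c

    linearGrowth : Vertex → ∃ λ G̃ → IsSubdivisionOf G̃ G × (∃ λ f → IsGrowth G̃ f ×
                   (∀ r → 1 ≤ r → f r ≤ 9 * (k * Δ * r)))
    linearGrowth v =
      let f , isGrowth , attained = growth (branch v)
      in subdivision , isSubdivision , f , isGrowth , λ r 1≤r →
           ≤-trans (≤-reflexive (proj₂ (attained r))) (∣ball∣≤ (proj₁ (attained r)) 1≤r)

  -- Simple paths and rooted trees.

  data Path {A : Set a} (R : Rel A c) : A → List A → A → Set (a Level.⊔ c) where
    []  : ∀ {x} → Path R x [] x
    _∷_ : ∀ {x y ys z} → R x y → Path R y ys z → Path R x (y ∷ ys) z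

  SimplePath : {A : Set a} → Rel A c → A → A → Set _
  SimplePath R x z = ∃ λ ys → Unique (x ∷ ys) × Path R x ys z

  module _ {R : Rel A c} where

    suffix : ∀ {x y ys z} → Unique (y ∷ ys) → Path R y ys z → x ∈ˡ y ∷ ys → SimplePath R x z
    suffix uniq       p       (here refl) = _ , uniq , p
    suffix (_ ∷ uniq) (_ ∷ p) (there x∈)  = suffix uniq p x∈

    -- Loop erasure: if the first vertex recurs on the simplified rest, only the part from the
    -- recurrence on is kept.
    simplify : (_≟ᴬ_ : DecidableEquality A) → ∀ {x z} → Star R x z → SimplePath R x z
    simplify _≟ᴬ_ ε = [] , All.[] ∷ [] , []
    simplify _≟ᴬ_ {x} (e ◅ es) with ys , uniq , p ← simplify _≟ᴬ_ es with any? (x ≟ᴬ_) (_ ∷ ys)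
    ... | yes x∈ = suffix uniq p x∈
    ... | no  x∉ = _ , ¬Any⇒All¬ _ x∉ ∷ uniq , e ∷ p

    linked-close : ∀ {S : Rel A c} → (∀ {x y} → R x y → S x y) →
                   ∀ {x ys z w} → Path R x ys z → S z w → Linked S (x ∷ ys ∷ʳ w)
    linked-close f []      s = s ∷ [-]
    linked-close f (e ∷ p) s = f e ∷ linked-close f p s

  module Rooted (T : Graph) (acyclic : Acyclic (Graph._∼_ T)) (root : Graph.Vertex T)
                (connected : ∀ t → Star (Graph._∼_ T) t root) where
    open Graph T renaming (sym to ∼-sym)
    open Balls T using (walk?)

    -- It suffices to exclude the step from x to y: a simple path from x never uses the step from y to x.
    no-detour : ∀ {x y} → x ∼ y → ¬ Star (λ u v → u ∼ v × ¬ (u ≡ x × v ≡ y)) x y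
    no-detour x∼y detour with simplify Fin._≟_ detour
    ... | [] , _ , []                        = irrefl refl x∼y
    ... | _ ∷ [] , _ , (_ , ≢xy) ∷ []        = ≢xy (refl , refl)
    ... | ys@(_ ∷ _ ∷ _) , uniq , p          =
      acyclic _ ys (s≤s (s≤s z≤n)) uniq (linked-close proj₁ p (∼-sym x∼y))

    shortest : ∀ t → ∃ λ m → Walk _∼_ m t root × (∀ {j} → Walk _∼_ j t root → m ≤ j)
    shortest t = least (λ m → walk? m t root) (proj₂ (Star⇒Walk (connected t)))

    depth : Vertex → ℕ
    depth t = proj₁ (shortest t)

    to-root : ∀ t → Walk _∼_ (depth t) t root
    to-root t = proj₁ (proj₂ (shortest t))

    depth-minimal : ∀ {t j} → Walk _∼_ j t root → depth t ≤ j
    depth-minimal {t} = proj₂ (proj₂ (shortest t))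

    -- The empty walk makes the root its own parent.
    next : ∀ {m t} → Walk _∼_ m t root → Vertex
    next {t = t} []          = t
    next (_∷_ {v = v} _ _)   = v

    parent : Vertex → Vertex
    parent t = next (to-root t)

    Avoiding : Vertex → Rel Vertex 0ℓ
    Avoiding x u v = u ∼ v × u ≢ x × v ≢ x

    -- If the walk met `x` after its start, the rest from `x` would be a walk to the root shorter
    -- than `depth x`.
    avoiding-walk : ∀ {x m y} → y ≢ x → Walk _∼_ m y root → m ≤ depth x → Star (Avoiding x) y root
    avoiding-walk y≢x []      m≤ = ε
    avoiding-walk y≢x (e ∷ p) m≤ = (e , y≢x , v≢x) ◅ avoiding-walk v≢x p (<⇒≤ m≤)
      where v≢x = λ { refl → n≮n _ (≤-trans m≤ (depth-minimal p)) }

    -- Otherwise the shortest walks from y and z to the root, which avoid x, give a detour for the edge xz.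
    lower-neighbour-unique : ∀ {x y z m} → x ∼ y → x ∼ z →
                             depth y ≤ depth x → Walk _∼_ m z root → m ≤ depth x → y ≡ z
    lower-neighbour-unique {x} {y} {z} x∼y x∼z y≤ walk m≤ with y Fin.≟ z
    ... | yes y≡z = y≡z
    ... | no  y≢z = contradiction
      ((x∼y , y≢z ∘ proj₂) ◅ Star.map forget
        (avoiding-walk (λ { refl → irrefl refl x∼y }) (to-root y) y≤
         ◅◅ Star.reverse (λ { (e , u≢ , v≢) → ∼-sym e , v≢ , u≢ })
              (avoiding-walk (λ { refl → irrefl refl x∼z }) walk m≤)))
      (no-detour x∼z)
      where
      forget : ∀ {u v} → Avoiding x u v → u ∼ v × ¬ (u ≡ x × v ≡ z)
      forget (e , u≢x , _) = e , u≢x ∘ proj₁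

    -- The second vertex of the shortest walk from `x` is also a neighbour no deeper than `x`, so
    -- uniqueness identifies it with `y`. If that walk is empty, `x` is the root and `y` would equal
    -- `x`.
    lower-neighbour : ∀ {x y} → x ∼ y → depth y ≤ depth x → y ≡ parent x × depth x ≡ suc (depth y)
    lower-neighbour {x} {y} x∼y y≤x = go (to-root x) ≤-refl
      where
      go : ∀ {m} (p : Walk _∼_ m x root) → m ≤ depth x → y ≡ next p × depth x ≡ suc (depth y)
      go [] _ with depth y | to-root y | ≤-trans y≤x (depth-minimal [])
      ... | zero | [] | _ = contradiction x∼y (irrefl refl)
      go (e ∷ p) m< with refl ← lower-neighbour-unique x∼y e y≤x p (<⇒≤ m<) =
        refl , ≤-antisym (depth-minimal (x∼y ∷ to-root y)) (≤-trans (s≤s (depth-minimal p)) m<)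

    neighbour : ∀ {x y} → x ∼ y → (y ≡ parent x × depth x ≡ suc (depth y))
                                ⊎ (x ≡ parent y × depth y ≡ suc (depth x))
    neighbour {x} {y} x∼y with ≤-total (depth y) (depth x)
    ... | inj₁ y≤x = inj₁ (lower-neighbour x∼y y≤x)
    ... | inj₂ x≤y = inj₂ (lower-neighbour (∼-sym x∼y) x≤y)

    depth-parent : ∀ {t} → 1 ≤ depth t → depth t ≡ suc (depth (parent t))
    depth-parent {t} 1≤ = go (to-root t) ≤-refl
      where
      go : ∀ {m} (p : Walk _∼_ m t root) → m ≤ depth t → depth t ≡ suc (depth (next p))
      go []      _  = contradiction (depth-minimal []) (<⇒≱ 1≤)
      go (e ∷ p) m< = ≤-antisym (depth-minimal (e ∷ to-root _)) (≤-trans (s≤s (depth-minimal p)) m<)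

    up : ℕ → Vertex → Vertex
    up zero    t = t
    up (suc j) t = up j (parent t)

    -- Meaningful only when d ≤ depth t; otherwise it is t itself.
    ancestor : ℕ → Vertex → Vertex
    ancestor d t = up (depth t ∸ d) t

    ancestor-self : ∀ t → ancestor (depth t) t ≡ t
    ancestor-self t = cong (λ j → up j t) (n∸n≡0 (depth t))

    ancestor-parent : ∀ {d t} → d < depth t → ancestor d t ≡ ancestor d (parent t)
    ancestor-parent {d} {t} d<t = cong (λ j → up j t) (trans (cong (_∸ d) eq) (+-∸-assoc 1 d≤))
      where
      eq = depth-parent (≤-trans (s≤s z≤n) d<t)
      d≤ : d ≤ depth (parent t)
      d≤ = ≤-pred (subst (d <_) eq d<t)

    -- Replace `t` by its parent until depth `d′` is reached; neither side changes.
    ancestor-ancestor : ∀ {d d′ t} → d ≤ d′ → d′ ≤ depth t → ancestor d (ancestor d′ t) ≡ ancestor d t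
    ancestor-ancestor {d} {d′} {t} d≤d′ d′≤t = go (depth t) refl d′≤t
      where
      go : ∀ {t} m → depth t ≡ m → d′ ≤ depth t → ancestor d (ancestor d′ t) ≡ ancestor d t
      go {t} m eq d′≤t with m≤n⇒m<n∨m≡n d′≤t
      go {t} m eq d′≤t | inj₂ refl = cong (ancestor d) (ancestor-self t)
      go {t} zero eq d′≤t | inj₁ d′<t = contradiction (≤-trans d′<t (≤-reflexive eq)) λ ()
      go {t} (suc m) eq d′≤t | inj₁ d′<t = begin
        ancestor d (ancestor d′ t)           ≡⟨ cong (ancestor d) (ancestor-parent d′<t) ⟩
        ancestor d (ancestor d′ (parent t))  ≡⟨ go m (suc-injective (trans (sym t≡) eq))
                                                    (≤-pred (subst (d′ <_) t≡ d′<t)) ⟩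
        ancestor d (parent t)                ≡⟨ ancestor-parent (≤-<-trans d≤d′ d′<t) ⟨
        ancestor d t                         ∎
        where
        open ≡-Reasoning
        t≡ = depth-parent (≤-trans (s≤s z≤n) d′<t)

    module Subtree {P : Vertex → Set} (P? : ∀ t → Dec (P t)) (connectedP : Connected P _∼_) where

      shallowest : ∃ λ t → P t × (∀ {s} → P s → depth t ≤ depth s)
      shallowest with d , (t , pt , refl) , minimal ←
          least {P = λ d → ∃ λ t → P t × depth t ≡ d} (λ d → Fin.any? λ t → P? t ×-dec (depth t ≟ d))
                (proj₁ (proj₁ connectedP) , proj₂ (proj₁ connectedP) , refl)
        = t , pt , λ ps → minimal (_ , ps , refl)

      top : Vertex
      top = proj₁ shallowest

      top∈ : P top
      top∈ = proj₁ (proj₂ shallowest)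

      top-minimal : ∀ {s} → P s → depth top ≤ depth s
      top-minimal = proj₂ (proj₂ shallowest)

      -- A subtree of a rooted tree has a single highest node and contains the upward path from each
      -- of its nodes to it. This is recorded node by node so that it can be carried along walks
      -- inside `P`.
      record Below (s : Vertex) : Set where
        field
          ∈P           : P s
          ancestor-top : ancestor (depth top) s ≡ top
          ancestor∈    : ∀ {d} → depth top ≤ d → d ≤ depth s → P (ancestor d s)

      below-top : Below top
      below-top = record
        { ∈P           = top∈
        ; ancestor-top = ancestor-self top
        ; ancestor∈    = λ top≤d d≤top → subst P
            (sym (trans (cong (λ d → ancestor d top) (≤-antisym d≤top top≤d)) (ancestor-self top))) top∈
        }

      -- A step inside `P` goes to the parent or to a child. In the first case the upward path loses
      -- `x`, and minimality of `top` keeps `y` at or below its depth; in the second it gains `y`,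
      -- which is in `P`.
      below-step : ∀ {x y} → Below x → P y → x ∼ y → Below y
      below-step {x} {y} bx py x∼y with neighbour x∼y
      ... | inj₁ (refl , x≡) = record
        { ∈P           = py
        ; ancestor-top = trans (sym (ancestor-parent (<x (top-minimal py)))) (Below.ancestor-top bx)
        ; ancestor∈    = λ top≤d d≤y → subst P (ancestor-parent (<x d≤y))
            (Below.ancestor∈ bx top≤d (<⇒≤ (<x d≤y)))
        }
        where
        <x : ∀ {d} → d ≤ depth y → d < depth x
        <x d≤y = subst (_ <_) (sym x≡) (s≤s d≤y)
      ... | inj₂ (refl , y≡) = record
        { ∈P           = py
        ; ancestor-top = trans (ancestor-parent (<y (top-minimal (Below.∈P bx)))) (Below.ancestor-top bx)
        ; ancestor∈    = λ {d} top≤d d≤y → case d top≤d (m≤n⇒m<n∨m≡n d≤y)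
        }
        where
        <y : ∀ {d} → d ≤ depth x → d < depth y
        <y d≤x = subst (_ <_) (sym y≡) (s≤s d≤x)

        case : ∀ d → depth top ≤ d → d < depth y ⊎ d ≡ depth y → P (ancestor d y)
        case d top≤d (inj₁ d<y)  = subst P (sym (ancestor-parent d<y))
          (Below.ancestor∈ bx top≤d (≤-pred (subst (d <_) y≡ d<y)))
        case d top≤d (inj₂ refl) = subst P (sym (ancestor-self y)) py

      below : ∀ {s} → P s → Below s
      below ps = go below-top (proj₂ connectedP top∈ ps)
        where
        go : ∀ {x y} → Below x → Star (λ u v → P u × P v × u ∼ v) x y → Below y
        go bx ε                    = bx
        go bx ((_ , py , e) ◅ es) = go (below-step bx py e) es

  -- The layering given by a tree-decomposition.

  module _ {G : Graph} (D : TreeDecomposition G) {k : ℕ} (width<k : TreeDecomposition.width D < k) where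
    open Graph G using () renaming (_∼_ to _∼ᴳ_; Vertex to Vertexᴳ)
    open TreeDecomposition D
    open Graph tree using (Vertex; _∼_; order)

    root : Vertex
    root = proj₁ (proj₁ (proj₁ isTree))

    open Rooted tree (proj₂ isTree) root
      (λ t → Star.map (proj₂ ∘ proj₂) (proj₂ (proj₁ isTree) {t} {root} tt tt))

    ∣bag∣≤k : ∀ t → ∣ bag t ∣ ≤ k
    ∣bag∣≤k t = ≤-trans (All.lookup (xs≤max 0 (map (∣_∣ ∘ bag) (allFin order))) (∈-map⁺ (∣_∣ ∘ bag) (∈-allFin t)))
      -- The largest bag size is at most `width + 1`, also when the subtraction in `width`
      -- truncates.
      (≤-trans (m≤n+m∸n _ 1) width<k)

    module At (v : Vertexᴳ) = Subtree (λ t → v ∈? bag t) (subtree v)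

    maxHeight : ∃ λ H → ∀ v → depth (At.top v) ≤ H
    maxHeight = Fin-bounded (λ v → depth (At.top v))

    -- Height `i` corresponds to depth `H ∸ i`, which for `i ≥ H` is the depth of the root. For
    -- `same`, a bag `s` containing both ends of an edge lies below both topmost nodes, so the two
    -- ancestors at depth `H ∸ i` are both the ancestor of `s`. For `cut`, the topmost node of `w`
    -- is no deeper than `H ∸ i` and `s` no higher, so the upward path from `s` inside the subtree
    -- of `w` passes through the separating node. For `own`, that node is the topmost one itself.
    layering : Layering G k
    layering = record
      { height      = height
      ; separator   = λ i v → bag (ancestor (H ∸ i) (At.top v))
      ; ∣separator∣ = λ i v → ∣bag∣≤k _
      ; same        = λ {i} {v} {w} e hv≤i hw≤i → let s , v∈ , w∈ = edgeCovered e in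
          cong bag (trans (via v v∈ (depth≥ v hv≤i)) (sym (via w w∈ (depth≥ w hw≤i))))
      ; own         = λ v → subst (λ t → v ∈ bag t)
          (sym (trans (cong (λ d → ancestor d (At.top v)) (m∸[m∸n]≡n (proj₂ maxHeight v))) (ancestor-self _)))
          (At.top∈ v)
      ; cut         = λ {i} {v} {w} e hv≤i i<hw → let s , v∈ , w∈ = edgeCovered e in
          subst (λ t → w ∈ bag t) (sym (via v v∈ (depth≥ v hv≤i)))
            (At.Below.ancestor∈ (At.below w w∈)
              (subst (_≤ H ∸ i) (m∸[m∸n]≡n (proj₂ maxHeight w)) (∸-monoʳ-≤ H (<⇒≤ i<hw)))
              (≤-trans (depth≥ v hv≤i) (At.top-minimal v v∈)))
      }
      where
      H = proj₁ maxHeight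

      height : Vertexᴳ → ℕ
      height v = H ∸ depth (At.top v)

      depth≥ : ∀ {i} v → height v ≤ i → H ∸ i ≤ depth (At.top v)
      depth≥ {i} v h≤i = m≤n+o⇒m∸n≤o H i
        (≤-trans (m≤n+m∸n H (depth (At.top v)))
          (≤-trans (+-monoʳ-≤ (depth (At.top v)) h≤i) (≤-reflexive (+-comm _ i))))

      via : ∀ {s d} v → v ∈ bag s → d ≤ depth (At.top v) → ancestor d (At.top v) ≡ ancestor d s
      via {s} {d} v v∈ d≤ = begin
        ancestor d (At.top v)                         ≡⟨ cong (ancestor d) (At.Below.ancestor-top (At.below v v∈)) ⟨
        ancestor d (ancestor (depth (At.top v)) s)    ≡⟨ ancestor-ancestor d≤ (At.top-minimal v v∈) ⟩
        ancestor d s                                  ∎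
        where open ≡-Reasoning

open LinearGrowth using (layering; module Counting)

open import Data.Nat using (ℕ; _*_; _^_) renaming (_≤_ to _≤ℕ_)
open import Data.Product using (∃; _×_)
open import Data.Rational using (ℚ; 0ℚ; 1ℚ; _+_; _≤_; _<_) renaming (_*_ to _*ℚ_)
open import Relation.Binary.PropositionalEquality using (_≡_)
open import Data.Fin using (Fin; zero)
open import Data.Integer as ℤ using (+_)
import Data.Integer.Properties as ℤ
open import Data.List using (allFin; map)
open import Data.List.Extrema.Nat using (xs≤max)
open import Data.List.Membership.Propositional.Properties using (∈-allFin; ∈-map⁺)
open import Data.List.Relation.Unary.All as All using ()
open import Data.Nat as ℕ using (suc; zero; s≤s; z≤n)
import Data.Nat.Properties as ℕ
open import Data.Nat.Tactic.RingSolver using (solve-∀)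
open import Data.Product using (_,_)
open import Data.Rational using (toℚᵘ; nonNegative)
import Data.Rational.Properties as ℚ
import Data.Rational.Unnormalised as ℚᵘ
import Data.Rational.Unnormalised.Properties as ℚᵘ
open import Relation.Binary.PropositionalEquality using (refl; cong)

-- Passing to rational bounds and conclusion.

fromℕ-toℚᵘ : ∀ m → toℚᵘ (fromℕ m) ℚᵘ.≃ ℚᵘ.mkℚᵘ (+ m) 0
fromℕ-toℚᵘ m = ℚ.toℚᵘ-fromℚᵘ (ℚᵘ.mkℚᵘ (+ m) 0)

fromℕ-mono-≤ : ∀ {m n} → m ≤ℕ n → fromℕ m ≤ fromℕ n
fromℕ-mono-≤ {m} {n} m≤n = ℚ.toℚᵘ-cancel-≤ (begin
  toℚᵘ (fromℕ m)     ≃⟨ fromℕ-toℚᵘ m ⟩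
  ℚᵘ.mkℚᵘ (+ m) 0    ≤⟨ ℚᵘ.*≤* (ℤ.*-monoʳ-≤-nonNeg (+ 1) (ℤ.+≤+ m≤n)) ⟩
  ℚᵘ.mkℚᵘ (+ n) 0    ≃⟨ fromℕ-toℚᵘ n ⟨
  toℚᵘ (fromℕ n)     ∎)
  where open ℚᵘ.≤-Reasoning

fromℕ-* : ∀ m n → fromℕ (m * n) ≡ fromℕ m *ℚ fromℕ n
fromℕ-* m n = ℚ.toℚᵘ-injective (begin-equality
  toℚᵘ (fromℕ (m * n))                     ≃⟨ fromℕ-toℚᵘ (m * n) ⟩
  ℚᵘ.mkℚᵘ (+ (m * n)) 0                    ≃⟨ ℚᵘ.*≡* (cong (ℤ._* + 1) (ℤ.pos-* m n)) ⟩
  ℚᵘ.mkℚᵘ (+ m) 0 ℚᵘ.* ℚᵘ.mkℚᵘ (+ n) 0     ≃⟨ ℚᵘ.*-cong (fromℕ-toℚᵘ m) (fromℕ-toℚᵘ n) ⟨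
  toℚᵘ (fromℕ m) ℚᵘ.* toℚᵘ (fromℕ n)       ≃⟨ ℚ.toℚᵘ-homo-* (fromℕ m) (fromℕ n) ⟨
  toℚᵘ (fromℕ m *ℚ fromℕ n)                ∎)
  where open ℚᵘ.≤-Reasoning

-- Both `ε *ℚ fromℕ r` and `1ℚ` are nonnegative, so the bound on natural numbers implies the
-- rational one.
linear-bound : ∀ {ε} → 0ℚ < ε → ∀ {m} A r → m ≤ℕ A * r →
               fromℕ m ≤ (fromℕ A + ε) *ℚ fromℕ r + 1ℚ
linear-bound {ε} 0<ε {m} A r m≤ = begin
  fromℕ m                                  ≤⟨ fromℕ-mono-≤ m≤ ⟩
  fromℕ (A * r)                            ≡⟨ fromℕ-* A r ⟩
  fromℕ A *ℚ fromℕ r                       ≡⟨ cong (_*ℚ fromℕ r) (ℚ.+-identityʳ (fromℕ A)) ⟨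
  (fromℕ A + 0ℚ) *ℚ fromℕ r                ≤⟨ ℚ.*-monoʳ-≤-nonNeg (fromℕ r) {{nonNegative (fromℕ-mono-≤ {0} {r} z≤n)}}
                                                (ℚ.+-monoʳ-≤ (fromℕ A) (ℚ.<⇒≤ 0<ε)) ⟩
  (fromℕ A + ε) *ℚ fromℕ r                 ≡⟨ ℚ.+-identityʳ _ ⟨
  (fromℕ A + ε) *ℚ fromℕ r + 0ℚ            ≤⟨ ℚ.+-monoʳ-≤ ((fromℕ A + ε) *ℚ fromℕ r) (fromℕ-mono-≤ {0} {1} z≤n) ⟩
  (fromℕ A + ε) *ℚ fromℕ r + 1ℚ            ∎
  where open ℚ.≤-Reasoning

degree≤maxDegree : ∀ G v → Graph.degree G v ≤ℕ Graph.maxDegree G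
degree≤maxDegree G v =
  All.lookup (xs≤max 0 (map (Graph.degree G) (allFin (Graph.order G)))) (∈-map⁺ (Graph.degree G) (∈-allFin v))

vertex : ∀ G → 1 ≤ℕ Graph.maxDegree G → Graph.Vertex G
-- The maximum over the empty list is the default 0, which contradicts the hypothesis.
vertex record { order = zero }  ()
vertex record { order = suc _ } _ = zero

1≤size : ∀ {n} → Fin n → 1 ≤ℕ n
1≤size {suc n} _ = s≤s z≤n

theorem17 : (k Δ : ℕ) → 1 ≤ℕ k → 1 ≤ℕ Δ → (ε : ℚ) → 0ℚ < ε →
    (G : Graph) → Graph.maxDegree G ≡ Δ → TreewidthLessThan G k →
    ∃ λ G̃ → IsSubdivisionOf G̃ G × (∃ λ f → IsGrowth G̃ f ×
    (∀ r → 1 ≤ℕ r →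
    fromℕ (f r) ≤ (fromℕ (18 * k * Δ ^ 2) + ε) *ℚ fromℕ r + 1ℚ))
theorem17 k Δ 1≤k 1≤Δ ε 0<ε G refl (w , ((D , refl) , _) , w<k) =
  let v = vertex G 1≤Δ
      G̃ , isSubdivision , f , isGrowth , f≤ =
        Counting.linearGrowth G 1≤k 1≤Δ (1≤size v) (degree≤maxDegree G) (layering D w<k) v
  in G̃ , isSubdivision , f , isGrowth , λ r 1≤r →
       linear-bound 0<ε (18 * k * Δ ^ 2) r (ℕ.≤-trans (f≤ r 1≤r) (constant≤ r))
  where
  open ℕ.≤-Reasoning

  -- The factor `d * 1` mirrors the unfolding of `Δ ^ 2` to `Δ * (Δ * 1)`, so that comparing factor
  -- by factor leaves only `1 ≤ Δ`.
  regroup : ∀ k d r → 9 * (k * d * r) ≡ 9 * k * (d * 1) * r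
  regroup = solve-∀

  constant≤ : ∀ r → 9 * (k * Δ * r) ≤ℕ 18 * k * Δ ^ 2 * r
  constant≤ r = begin
    9 * (k * Δ * r)       ≡⟨ regroup k Δ r ⟩
    9 * k * (Δ * 1) * r   ≤⟨ ℕ.*-monoˡ-≤ r (ℕ.*-mono-≤ (ℕ.*-monoˡ-≤ k (ℕ.m≤m+n 9 9))
                               (ℕ.*-monoʳ-≤ Δ (ℕ.*-mono-≤ 1≤Δ (ℕ.≤-refl {1})))) ⟩
    18 * k * Δ ^ 2 * r    ∎
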